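{- For every $\varepsilon>0$ there exists an integer $n_0(\varepsilon)$ such that every edge-colored complete balanced bipartite graph $K^c_{n,n}$ with $n\geq n_0(\varepsilon)$ and $\delta^c(K^c_{n,n})\geq (\frac{2}{3}+\varepsilon)n$ is vertex-even-pancyclic, i.e., for every vertex $u$ of $K^c_{n,n}$ and every even integer $k$ with $4\le k\le 2n$, there is a properly colored cycle of length $k$ containing $u$.
   Context: $K^c_{n,n}$ denotes the complete bipartite graph $K_{n,n}$ together with an arbitrary assignment of a color to each edge. A subgraph is properly colored if every two adjacent edges of it have distinct colors. The color degree of a vertex is the number of distinct colors on its incident edges, and $\delta^c(K^c_{n,n})$ is the minimum color degree over all vertices. -}

module Defs where

open import Data.Nat using (ℕ; zero; suc; _%_)
open import Data.Nat.DivMod using (m%n<n)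
open import Data.Fin using (Fin; toℕ; fromℕ<)

open import Data.List using (List; length; map; deduplicate; allFin)
open import Data.Sum using (_⊎_; inj₁; inj₂)
open import Data.Unit using (⊤)
open import Data.Empty using (⊥)
open import Data.Product using (Σ; ∃; _×_; _,_)
open import Function.Definitions using (Injective)
open import Relation.Binary.PropositionalEquality using (_≡_; _≢_)
import Data.Nat as ℕ

-- An edge-coloured K_{n,n}: left part Fin n, right part Fin n,
-- the edge {left i, right j} gets colour  c i j  (colours are naturals).
Coloring : ℕ → Set
Coloring n = Fin n → Fin n → ℕ

-- Vertices of K_{n,n}: inj₁ i = left vertex i, inj₂ j = right vertex j.
Vertex : ℕ → Set
Vertex n = Fin n ⊎ Fin n

Adj : ∀ {n} → Vertex n → Vertex n → Set
Adj (inj₁ _) (inj₁ _) = ⊥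
Adj (inj₁ _) (inj₂ _) = ⊤
Adj (inj₂ _) (inj₁ _) = ⊤
Adj (inj₂ _) (inj₂ _) = ⊥

-- Colour of the edge between two vertices (value on non-edges is irrelevant).
edgeColor : ∀ {n} → Coloring n → Vertex n → Vertex n → ℕ
edgeColor c (inj₁ i) (inj₂ j) = c i j
edgeColor c (inj₂ j) (inj₁ i) = c i j
edgeColor c (inj₁ _) (inj₁ _) = 0
edgeColor c (inj₂ _) (inj₂ _) = 0

neighbours : ∀ {n} → Vertex n → List (Vertex n)
neighbours {n} (inj₁ _) = map inj₂ (allFin n)
neighbours {n} (inj₂ _) = map inj₁ (allFin n)

colorDegree : ∀ {n} → Coloring n → Vertex n → ℕ
colorDegree c v = length (deduplicate ℕ._≟_ (map (edgeColor c v) (neighbours v)))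

next : ∀ {k} → Fin k → Fin k
next {suc k} i = fromℕ< (m%n<n (suc (toℕ i)) (suc k))

IsCycle : ∀ {n} k → (Fin k → Vertex n) → Set
IsCycle k C = Injective _≡_ _≡_ C × (∀ i → Adj (C i) (C (next i)))

ProperlyColored : ∀ {n} {k} → Coloring n → (Fin k → Vertex n) → Set
ProperlyColored c C =
  ∀ i → edgeColor c (C i) (C (next i)) ≢ edgeColor c (C (next i)) (C (next (next i)))

HasPCCycleThrough : ∀ {n} → Coloring n → ℕ → Vertex n → Set
HasPCCycleThrough {n} c k u =
  Σ (Fin k → Vertex n) λ C → IsCycle k C × ProperlyColored c C × ∃ λ i → C i ≡ u

{-# OPTIONS --safe #-}

-- Fix K and call an edge large at an endpoint if more than K edges there have its colour. The
-- colour degree makes every colour class smaller than n/3, and fewer than (1/3 − ε′)n edges at a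
-- vertex are large at it. A perfect matching M turns K_{n,n} into a digraph on the edges ("tiles")
-- (lᵢ, rᵢ) of M, with i → j if the colour of lⱼrᵢ differs from those of tiles i and j; directed
-- cycles of length m are properly coloured cycles of length 2m, through both ends of their tiles.
--
-- M is chosen so that no tile is large at both of its ends, and, subject to this, as a local
-- minimum under exchanges of two tiles of W · #{large ends of tiles} + Σ_z P_z², where P_z is
-- the number of tiles that have, and are small in, the colour by which they see the vertex z.
-- Averaging over all exchanges bounds the number of large ends by (2/3 − ε″)n and each P_z by o(n).
--
-- Starting with the loops i → i, every missing arc i → σ i that is small at one end can be repaired by
-- exchanging the images of i and some j; loops are such since no tile is large at both ends. This
-- gives a permutation σ along arcs, and the same count merges its cycles into a single one.
-- Finally, if one tile t is left out and σ is a Hamilton cycle of the others, then for each m some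
-- v satisfies t → v and σ^{m−2} v → t, since t misses fewer than n − 1 arcs in total.
module Submission where

open import Defs
open import Data.Nat
open import Data.Nat.Properties hiding (_≟_)
open import Data.Nat.Properties using () renaming (_≟_ to _≟ℕ_)
open import Data.Nat.DivMod using (m<n⇒m%n≡m; n%n≡0; m%n<n; m/n*n≤m; m*n/n≡m; /-monoˡ-≤)
open import Data.Nat.Induction using (Acc; acc; <-wellFounded)
open import Data.Nat.Tactic.RingSolver using (solve-∀)
open import Data.Fin using (Fin; zero; suc; toℕ; fromℕ<; splitAt; _↑ˡ_; _↑ʳ_)
import Data.Fin.Properties as Fin
open import Data.Fin.Permutation as Perm using (Permutation′; _⟨$⟩ʳ_; _⟨$⟩ˡ_; _∘ₚ_; transpose)
open import Data.List using (List; []; _∷_; _++_; length; lookup; map; deduplicate; allFin)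
open import Data.List.Properties using (map-∘; length-++)
open import Data.List.Membership.Propositional using (_∈_; _∉_)
open import Data.List.Membership.Propositional.Properties using (∈-deduplicate⁻; ∈-lookup; ∈-map⁻; ∈-∃++)
open import Data.List.Relation.Unary.Any using (here; there)
open import Data.List.Relation.Unary.Any.Properties using (lookup-index)
open import Data.List.Relation.Unary.All as All using (All; []; _∷_)
open import Data.List.Relation.Unary.All.Properties using (¬Any⇒All¬)
open import Data.List.Relation.Unary.AllPairs using ([]; _∷_)
open import Data.List.Relation.Unary.Unique.Propositional using (Unique)
open import Data.List.Relation.Unary.Unique.Propositional.Properties using (++⁺; Unique[x∷xs]⇒x∉xs)
open import Data.List.Relation.Unary.Unique.DecPropositional.Properties _≟ℕ_ using (deduplicate-!)
open import Data.List.Relation.Binary.Permutation.Propositional using (_↭_; prep; swap; ↭-refl; ↭-sym; ↭-trans; ↭⇒↭ₛ)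
open import Data.List.Relation.Binary.Permutation.Propositional.Properties using (∈-resp-↭; ↭-length; ++-comm; shift)
import Data.List.Relation.Binary.Permutation.Setoid.Properties as SetoidPerm
open import Data.Product using (∃; ∃₂; _×_; _,_; proj₁; proj₂)
open import Data.Sum using (_⊎_; inj₁; inj₂; [_,_]′)
import Data.Sum as Sum
open import Data.Sum.Properties using (inj₁-injective; inj₂-injective)
open import Data.Unit using (⊤; tt)
open import Function using (_∘_)
open import Function.Definitions using (Injective)
open import Relation.Nullary using (Dec; yes; no; ¬_; contradiction)
open import Relation.Nullary.Decidable using (¬?; _×-dec_; _⊎-dec_; decidable-stable)
open import Relation.Binary.PropositionalEquality
open import Algebra.Properties.Semiring.Sum +-*-semiring using (sum-cong-≗; ∑-distrib-+; ∑-comm; *-distribˡ-sum; *-distribʳ-sum) renaming (sum to ∑)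

-- Sums over Fin n

∑-mono : ∀ {n} {f g : Fin n → ℕ} → (∀ i → f i ≤ g i) → ∑ f ≤ ∑ g
∑-mono {zero}  p = z≤n
∑-mono {suc n} p = +-mono-≤ (p zero) (∑-mono (p ∘ suc))

∑-const : ∀ n k → ∑ {n} (λ _ → k) ≡ n * k
∑-const zero    k = refl
∑-const (suc n) k = cong (k +_) (∑-const n k)

∑-bound : ∀ {n} {f : Fin n → ℕ} k → (∀ i → f i ≤ k) → ∑ f ≤ n * k
∑-bound {n} k p = ≤-trans (∑-mono p) (≤-reflexive (∑-const n k))

∑-term : ∀ {n} (f : Fin n → ℕ) i → f i ≤ ∑ f
∑-term f zero    = m≤m+n _ _
∑-term f (suc i) = ≤-trans (∑-term (f ∘ suc) i) (m≤n+m _ _)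

∑-split : ∀ m {n} (f : Fin (m + n) → ℕ) → ∑ f ≡ ∑ (λ i → f (i ↑ˡ n)) + ∑ (λ i → f (m ↑ʳ i))
∑-split zero    f = refl
∑-split (suc m) f = trans (cong (f zero +_) (∑-split m (f ∘ suc))) (sym (+-assoc (f zero) _ _))

-- If all n values were positive, the sum would be at least n. The existence proofs below count
-- obstructions in such a sum and extract an index free of them.
∑<n⇒zero : ∀ {n} (f : Fin n → ℕ) → ∑ f < n → ∃ λ i → f i ≡ 0
∑<n⇒zero {suc n} f ∑f<n with f zero in eq
... | zero  = zero , eq
... | suc k with ∑<n⇒zero (f ∘ suc) (≤-trans (s≤s (m≤n+m _ k)) (s≤s⁻¹ ∑f<n))
...   | i , fi≡0 = suc i , fi≡0

ind : ∀ {P : Set} → Dec P → ℕ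
ind (yes _) = 1
ind (no  _) = 0

ind-yes : ∀ {P : Set} (P? : Dec P) → P → ind P? ≡ 1
ind-yes (yes _) p = refl
ind-yes (no ¬p) p = contradiction p ¬p

ind-no : ∀ {P : Set} (P? : Dec P) → ¬ P → ind P? ≡ 0
ind-no (yes p) ¬p = contradiction p ¬p
ind-no (no _)  ¬p = refl

ind≡0⇒¬ : ∀ {P : Set} (P? : Dec P) → ind P? ≡ 0 → ¬ P
ind≡0⇒¬ (no ¬p) _ = ¬p

ind≤1 : ∀ {P : Set} (P? : Dec P) → ind P? ≤ 1
ind≤1 (yes _) = ≤-refl
ind≤1 (no _)  = z≤n

∑-ind-no : ∀ {n} {P : Fin n → Set} (P? : ∀ i → Dec (P i)) → (∀ i → ¬ P i) → ∑ (λ i → ind (P? i)) ≡ 0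
∑-ind-no {zero}  P? ¬P = refl
∑-ind-no {suc n} P? ¬P = cong₂ _+_ (ind-no (P? zero) (¬P zero)) (∑-ind-no (P? ∘ suc) (¬P ∘ suc))

∑-ind≤1 : ∀ {n} {P : Fin n → Set} (P? : ∀ i → Dec (P i)) → (∀ {i j} → P i → P j → i ≡ j) → ∑ (λ i → ind (P? i)) ≤ 1
∑-ind≤1 {zero}  P? unique = z≤n
∑-ind≤1 {suc n} P? unique with P? zero
... | no  _ = ∑-ind≤1 (P? ∘ suc) λ p q → Fin.suc-injective (unique p q)
... | yes p = s≤s (≤-reflexive (∑-ind-no (P? ∘ suc) λ i q → zero≢suc (unique p q)))
  where zero≢suc : ∀ {i : Fin n} → zero ≡ suc i → _
        zero≢suc ()

∑-pick : ∀ {n} (i : Fin n) (f : Fin n → ℕ) → ∑ (λ k → ind (i Fin.≟ k) * f k) ≡ f i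
∑-pick {suc n} zero f = begin
  f zero + 0 + ∑ (λ k → ind (zero Fin.≟ suc k) * f (suc k)) ≡⟨ cong₂ _+_ (+-identityʳ (f zero)) (trans (∑-const n 0) (*-zeroʳ n)) ⟩
  f zero + 0                                              ≡⟨ +-identityʳ (f zero) ⟩
  f zero                                                  ∎
  where open ≡-Reasoning
∑-pick {suc n} (suc i) f = trans (sum-cong-≗ same-ind) (∑-pick i (f ∘ suc))
  where
  same-ind : ∀ k → ind (suc i Fin.≟ suc k) * f (suc k) ≡ ind (i Fin.≟ k) * f (suc k)
  same-ind k with i Fin.≟ k
  ... | yes _ = refl
  ... | no  _ = refl

-- After expanding f into point masses and interchanging the sums, each k is counted once per
-- preimage under `ρ`, hence at most once.
∑-inj : ∀ {m n} {ρ : Fin m → Fin n} → Injective _≡_ _≡_ ρ → ∀ (f : Fin n → ℕ) → ∑ (f ∘ ρ) ≤ ∑ f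
∑-inj {m} {n} {ρ} inj f = begin
  ∑ (f ∘ ρ)                                      ≡⟨ sum-cong-≗ (λ t → sym (∑-pick (ρ t) f)) ⟩
  ∑ (λ t → ∑ λ k → ind (ρ t Fin.≟ k) * f k)      ≡⟨ ∑-comm (λ t k → ind (ρ t Fin.≟ k) * f k) ⟩
  ∑ (λ k → ∑ λ t → ind (ρ t Fin.≟ k) * f k)      ≡⟨ sum-cong-≗ (λ k → sym (*-distribʳ-sum (f k) (λ t → ind (ρ t Fin.≟ k)))) ⟩
  ∑ (λ k → ∑ (λ t → ind (ρ t Fin.≟ k)) * f k)    ≤⟨ ∑-mono (λ k → *-monoˡ-≤ (f k) (∑-ind≤1 (λ t → ρ t Fin.≟ k) λ p q → inj (trans p (sym q)))) ⟩
  ∑ (λ k → 1 * f k)                              ≡⟨ sum-cong-≗ (λ k → *-identityˡ (f k)) ⟩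
  ∑ f                                            ∎
  where open ≤-Reasoning

-- Colour classes

δ : ℕ → ℕ → ℕ
δ a b = ind (a ≟ℕ b)

δ-sym : ∀ a b → δ a b ≡ δ b a
δ-sym a b with a ≟ℕ b
... | yes a≡b = sym (ind-yes (b ≟ℕ a) (sym a≡b))
... | no  a≢b = sym (ind-no (b ≟ℕ a) (a≢b ∘ sym))

class : ∀ {n} → (Fin n → ℕ) → ℕ → ℕ
class f a = ∑ λ k → δ (f k) a

large : ℕ → ∀ {n} → (Fin n → ℕ) → ℕ → ℕ
large K f a = ind (K <? class f a)

module _ {d n : ℕ} {f : Fin n → ℕ} (ρ : Fin d → Fin n) (rainbow : Injective _≡_ _≡_ (f ∘ ρ)) where

  ρ-inj : Injective _≡_ _≡_ ρ
  ρ-inj = rainbow ∘ cong f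

  once : ∀ a → ∑ (λ t → δ (f (ρ t)) a) ≤ 1
  once a = ∑-ind≤1 (λ t → f (ρ t) ≟ℕ a) λ p q → rainbow (trans p (sym q))

  -- `ρ` picks d edges of distinct colours among the n at a vertex. The n - d indices that it misses
  -- have weight at most 1 each; applying `∑-inj` to the complementary weights `1 ∸ w` avoids
  -- describing them.
  split-≤ : ∀ (w : Fin n → ℕ) → (∀ k → w k ≤ 1) → d + ∑ w ≤ n + ∑ (λ t → w (ρ t))
  split-≤ w w≤1 = begin
    d + ∑ w                                                ≡⟨ cong (_+ ∑ w) (trans (sym (*-identityʳ d)) (sym (∑-const d 1))) ⟩
    ∑ {d} (λ _ → 1) + ∑ w                                  ≡⟨ cong (_+ ∑ w) (sum-cong-≗ (λ t → sym (m∸n+n≡m (w≤1 (ρ t))))) ⟩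
    ∑ (λ t → 1 ∸ w (ρ t) + w (ρ t)) + ∑ w                  ≡⟨ cong (_+ ∑ w) (∑-distrib-+ (λ t → 1 ∸ w (ρ t)) (w ∘ ρ)) ⟩
    ∑ (λ t → 1 ∸ w (ρ t)) + ∑ (w ∘ ρ) + ∑ w                ≤⟨ +-monoˡ-≤ (∑ w) (+-monoˡ-≤ (∑ (w ∘ ρ)) (∑-inj ρ-inj (λ k → 1 ∸ w k))) ⟩
    ∑ (λ k → 1 ∸ w k) + ∑ (w ∘ ρ) + ∑ w                    ≡⟨ rearrange (∑ (λ k → 1 ∸ w k)) (∑ (w ∘ ρ)) (∑ w) ⟩
    ∑ (λ k → 1 ∸ w k) + ∑ w + ∑ (w ∘ ρ)                    ≡⟨ cong (_+ ∑ (w ∘ ρ)) (sym (∑-distrib-+ (λ k → 1 ∸ w k) w)) ⟩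
    ∑ (λ k → 1 ∸ w k + w k) + ∑ (w ∘ ρ)                    ≡⟨ cong (_+ ∑ (w ∘ ρ)) (sum-cong-≗ (λ k → m∸n+n≡m (w≤1 k))) ⟩
    ∑ {n} (λ _ → 1) + ∑ (w ∘ ρ)                            ≡⟨ cong (_+ ∑ (w ∘ ρ)) (trans (∑-const n 1) (*-identityʳ n)) ⟩
    n + ∑ (w ∘ ρ)                                          ∎
    where
    open ≤-Reasoning
    rearrange : ∀ a b c → a + b + c ≡ a + c + b
    rearrange = solve-∀

  -- A colour meets the image of `ρ` at most once, so all but one of its edges lie among the n - d
  -- others.
  class-bound : ∀ a → d + class f a ≤ n + 1
  class-bound a = ≤-trans (split-≤ (λ k → δ (f k) a) (λ k → ind≤1 (f k ≟ℕ a))) (+-monoʳ-≤ n (once a))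

  -- Of the B large edges at most n - d lie outside the image of `ρ`. Those inside have distinct
  -- colours with more than K edges each, so there are at most B / (K + 1) of them. Hence K B ≤ (K +
  -- 1)(n - d).
  large-bound : ∀ K → suc K * d + K * ∑ (λ k → large K f (f k)) ≤ suc K * n
  large-bound K = +-cancelʳ-≤ B _ _ (begin
    suc K * d + K * B + B       ≡⟨ rearrange K d B ⟩
    suc K * (d + B)             ≤⟨ *-monoʳ-≤ (suc K) (split-≤ L (λ k → ind≤1 (K <? class f (f k)))) ⟩
    suc K * (n + ∑ (L ∘ ρ))     ≡⟨ *-distribˡ-+ (suc K) n (∑ (L ∘ ρ)) ⟩
    suc K * n + suc K * ∑ (L ∘ ρ) ≤⟨ +-monoʳ-≤ (suc K * n) large-colours ⟩
    suc K * n + B               ∎)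
    where
    open ≤-Reasoning
    L = λ k → large K f (f k)
    B = ∑ L
    rearrange : ∀ K d B → suc K * d + K * B + B ≡ suc K * (d + B)
    rearrange = solve-∀
    heavy : ∀ a → suc K * large K f a ≤ large K f a * class f a
    heavy a with K <? class f a
    ... | yes K< = ≤-trans (≤-reflexive (*-identityʳ (suc K))) (≤-trans K< (≤-reflexive (sym (+-identityʳ _))))
    ... | no  _  = ≤-reflexive (*-zeroʳ (suc K))
    transfer : ∀ t j → L (ρ t) * δ (f j) (f (ρ t)) ≡ L j * δ (f (ρ t)) (f j)
    transfer t j with f j ≟ℕ f (ρ t)
    ... | yes e rewrite e | ind-yes (f (ρ t) ≟ℕ f (ρ t)) refl = refl
    ... | no ¬e rewrite ind-no (f (ρ t) ≟ℕ f j) (¬e ∘ sym) = trans (*-zeroʳ (L (ρ t))) (sym (*-zeroʳ (L j)))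
    -- Count pairs (t, j) such that `ρ t` is large and j has its colour: each such t has more than K
    -- partners j, and each j at most one partner t.
    large-colours : suc K * ∑ (L ∘ ρ) ≤ B
    large-colours = begin
      suc K * ∑ (L ∘ ρ)                               ≡⟨ *-distribˡ-sum (suc K) (L ∘ ρ) ⟩
      ∑ (λ t → suc K * L (ρ t))                       ≤⟨ ∑-mono (λ t → heavy (f (ρ t))) ⟩
      ∑ (λ t → L (ρ t) * class f (f (ρ t)))           ≡⟨ sum-cong-≗ (λ t → *-distribˡ-sum (L (ρ t)) (λ j → δ (f j) (f (ρ t)))) ⟩
      ∑ (λ t → ∑ λ j → L (ρ t) * δ (f j) (f (ρ t)))   ≡⟨ sum-cong-≗ (λ t → sum-cong-≗ (transfer t)) ⟩
      ∑ (λ t → ∑ λ j → L j * δ (f (ρ t)) (f j))       ≡⟨ ∑-comm (λ t j → L j * δ (f (ρ t)) (f j)) ⟩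
      ∑ (λ j → ∑ λ t → L j * δ (f (ρ t)) (f j))       ≡⟨ sum-cong-≗ (λ j → sym (*-distribˡ-sum (L j) (λ t → δ (f (ρ t)) (f j)))) ⟩
      ∑ (λ j → L j * ∑ λ t → δ (f (ρ t)) (f j))       ≤⟨ ∑-mono (λ j → *-monoʳ-≤ (L j) (once (f j))) ⟩
      ∑ (λ j → L j * 1)                               ≡⟨ sum-cong-≗ (λ j → *-identityʳ (L j)) ⟩
      B                                               ∎

lookup-injective : ∀ {A : Set} {xs : List A} → Unique xs → ∀ {i j} → lookup xs i ≡ lookup xs j → i ≡ j
lookup-injective {xs = x ∷ xs} (x∉ ∷ u) {zero}  {zero}  e = refl
lookup-injective {xs = x ∷ xs} (x∉ ∷ u) {zero}  {suc j} e = contradiction e (All.lookup x∉ (∈-lookup j))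
lookup-injective {xs = x ∷ xs} (x∉ ∷ u) {suc i} {zero}  e = contradiction (sym e) (All.lookup x∉ (∈-lookup i))
lookup-injective {xs = x ∷ xs} (x∉ ∷ u) {suc i} {suc j} e = cong suc (lookup-injective u e)

transversal : ∀ {n} (f : Fin n → ℕ) → ∃ λ (ρ : Fin (length (deduplicate _≟ℕ_ (map f (allFin n)))) → Fin n) → Injective _≡_ _≡_ (f ∘ ρ)
transversal {n} f = ρ , λ {i} {j} e → lookup-injective (deduplicate-! (map f (allFin n))) (trans (spec i) (trans e (sym (spec j))))
  where
  xs = deduplicate _≟ℕ_ (map f (allFin n))
  preimage : ∀ i → ∃ λ k → k ∈ allFin n × lookup xs i ≡ f k
  preimage i = ∈-map⁻ f (∈-deduplicate⁻ _≟ℕ_ (map f (allFin n)) (∈-lookup i))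
  ρ : Fin (length xs) → Fin n
  ρ i = proj₁ (preimage i)
  spec : ∀ i → lookup xs i ≡ f (ρ i)
  spec i = proj₂ (proj₂ (preimage i))

colours : ∀ {n} → Coloring n → Vertex n → Fin n → ℕ
colours c (inj₁ i) j = c i j
colours c (inj₂ j) i = c i j

colorDegree-transversal : ∀ {n} (c : Coloring n) v → ∃ λ (ρ : Fin (colorDegree c v) → Fin n) → Injective _≡_ _≡_ (colours c v ∘ ρ)
colorDegree-transversal {n} c (inj₁ i) rewrite sym (map-∘ {g = edgeColor c (inj₁ i)} {f = inj₂} (allFin n)) = transversal (c i)
colorDegree-transversal {n} c (inj₂ j) rewrite sym (map-∘ {g = edgeColor c (inj₂ j)} {f = inj₁} (allFin n)) = transversal (λ i → c i j)

-- Permutations and transpositions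

perm-injective : ∀ {n} (π : Permutation′ n) → Injective _≡_ _≡_ (π ⟨$⟩ʳ_)
perm-injective π e = trans (sym (Perm.inverseˡ π)) (trans (cong (π ⟨$⟩ˡ_) e) (Perm.inverseˡ π))

swapAt : ∀ {n} → Fin n → Fin n → Permutation′ n → Permutation′ n
swapAt i j π = transpose i j ∘ₚ π

swapAt-i : ∀ {n} (i j : Fin n) π → swapAt i j π ⟨$⟩ʳ i ≡ π ⟨$⟩ʳ j
swapAt-i i j π with i Fin.≟ i
... | yes _  = refl
... | no i≢i = contradiction refl i≢i

swapAt-j : ∀ {n} (i j : Fin n) π → swapAt i j π ⟨$⟩ʳ j ≡ π ⟨$⟩ʳ i
swapAt-j i j π with j Fin.≟ i
... | yes refl = refl
... | no _ with j Fin.≟ j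
...   | yes _  = refl
...   | no j≢j = contradiction refl j≢j

swapAt-other : ∀ {n} (i j : Fin n) π {k} → k ≢ i → k ≢ j → swapAt i j π ⟨$⟩ʳ k ≡ π ⟨$⟩ʳ k
swapAt-other i j π {k} k≢i k≢j with k Fin.≟ i
... | yes k≡i = contradiction k≡i k≢i
... | no _ with k Fin.≟ j
...   | yes k≡j = contradiction k≡j k≢j
...   | no _    = refl

-- Only the pairs at i and j change, so a pairwise property survives an exchange once it is checked
-- there; i = j is allowed.
swapAt-elim : ∀ {n} (Q : Fin n → Fin n → Set) (i j : Fin n) π → Q i (π ⟨$⟩ʳ j) → Q j (π ⟨$⟩ʳ i) →
              ∀ {k} → Q k (π ⟨$⟩ʳ k) → Q k (swapAt i j π ⟨$⟩ʳ k)
swapAt-elim Q i j π qij qji {k} q = cases (k Fin.≟ i) (k Fin.≟ j)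
  where
  cases : Dec (k ≡ i) → Dec (k ≡ j) → Q k (swapAt i j π ⟨$⟩ʳ k)
  cases (yes refl) _          = subst (Q i) (sym (swapAt-i i j π)) qij
  cases (no _)     (yes refl) = subst (Q j) (sym (swapAt-j i j π)) qji
  cases (no k≢i)   (no k≢j)   = subst (Q k) (sym (swapAt-other i j π k≢i k≢j)) q

-- Repairing a permutation by exchanges

module Repair {n : ℕ} (Good Fixable : Fin n → Fin n → Set)
  (fix : ∀ (π : Permutation′ n) i → Fixable i (π ⟨$⟩ʳ i) →
         ∃ λ j → Good i (π ⟨$⟩ʳ j) × Good j (π ⟨$⟩ʳ i)) where

  State : Permutation′ n → Set
  State π = ∀ i → Good i (π ⟨$⟩ʳ i) ⊎ Fixable i (π ⟨$⟩ʳ i)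

  fixed : Permutation′ n → ℕ → Set
  fixed π k = ∀ i → toℕ i < k → Good i (π ⟨$⟩ʳ i)

  -- Both pairs created by the exchange are good, so repairing i spoils no good pair, even if j was
  -- repaired earlier. One pass through the indices therefore suffices.
  step : ∀ π → State π → ∀ i → Fixable i (π ⟨$⟩ʳ i) → ∃ λ π′ → State π′ × Good i (π′ ⟨$⟩ʳ i) ×
         (∀ k → Good k (π ⟨$⟩ʳ k) → Good k (π′ ⟨$⟩ʳ k))
  step π st i fi with fix π i fi
  ... | j , gij , gji = π′ , st′ , good-i , keep
    where
    π′ = swapAt i j π
    good-i : Good i (π′ ⟨$⟩ʳ i)
    good-i = subst (Good i) (sym (swapAt-i i j π)) gij
    st′ : State π′
    st′ k = swapAt-elim (λ x y → Good x y ⊎ Fixable x y) i j π (inj₁ gij) (inj₁ gji) (st k)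
    keep : ∀ k → Good k (π ⟨$⟩ʳ k) → Good k (π′ ⟨$⟩ʳ k)
    keep k = swapAt-elim Good i j π gij gji

  repairUpTo : ∀ π → State π → ∀ k → k ≤ n → ∃ λ π′ → State π′ × fixed π′ k
  repairUpTo π st zero    _   = π , st , λ _ ()
  repairUpTo π st (suc k) k<n with repairUpTo π st k (<⇒≤ k<n)
  ... | π₁ , st₁ , fx₁ with st₁ (fromℕ< k<n)
  ...   | inj₁ g = π₁ , st₁ , λ i i<sk → extend i (m≤n⇒m<n∨m≡n (s≤s⁻¹ i<sk))
    where
    extend : ∀ i → toℕ i < k ⊎ toℕ i ≡ k → Good i (π₁ ⟨$⟩ʳ i)
    extend i (inj₁ i<k)  = fx₁ i i<k
    extend i (inj₂ refl) = subst (λ x → Good x (π₁ ⟨$⟩ʳ x)) (Fin.fromℕ<-toℕ i k<n) g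
  ...   | inj₂ fi with step π₁ st₁ _ fi
  ...     | π₂ , st₂ , g , keep = π₂ , st₂ , λ i i<sk → extend i (m≤n⇒m<n∨m≡n (s≤s⁻¹ i<sk))
    where
    extend : ∀ i → toℕ i < k ⊎ toℕ i ≡ k → Good i (π₂ ⟨$⟩ʳ i)
    extend i (inj₁ i<k)  = keep i (fx₁ i i<k)
    extend i (inj₂ refl) = subst (λ x → Good x (π₂ ⟨$⟩ʳ x)) (Fin.fromℕ<-toℕ i k<n) g

  repair : ∀ π → State π → ∃ λ π′ → ∀ i → Good i (π′ ⟨$⟩ʳ i)
  repair π st with repairUpTo π st n ≤-refl
  ... | π′ , _ , fx = π′ , λ i → fx i (Fin.toℕ<n i)

-- Orbits of a map

module _ {N : ℕ} where

  open import Data.List.Membership.DecPropositional (Fin._≟_ {N}) using (_∈?_)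

  -- A nonempty list starts with a, and the end b is left out, so chains compose by plain
  -- concatenation.
  data Chain (σ : Fin N → Fin N) : Fin N → List (Fin N) → Fin N → Set where
    []   : ∀ {a} → Chain σ a [] a
    link : ∀ {a b xs} → Chain σ (σ a) xs b → Chain σ a (a ∷ xs) b

  -- `i ∷ p` runs once around the cycle of σ through i; a fixed point has p = [].
  IsOrbit : (Fin N → Fin N) → Fin N → List (Fin N) → Set
  IsOrbit σ i p = Chain σ (σ i) p i × Unique (i ∷ p)

  chain-++ : ∀ {σ a b c xs ys} → Chain σ a xs b → Chain σ b ys c → Chain σ a (xs ++ ys) c
  chain-++ []       q = q
  chain-++ (link p) q = link (chain-++ p q)

  chain-split : ∀ {σ a b i} xs {zs} → Chain σ a (xs ++ i ∷ zs) b → Chain σ a xs i × Chain σ (σ i) zs b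
  chain-split []       (link p) = [] , p
  chain-split (x ∷ xs) (link p) with chain-split xs p
  ... | q , r = link q , r

  chain-agree : ∀ {σ σ′ a b xs} → Chain σ a xs b → (∀ {x} → x ∈ xs → σ′ x ≡ σ x) → Chain σ′ a xs b
  chain-agree         []               agree = []
  chain-agree {σ′ = σ′} {b = b} (link {a = a} {xs = xs} p) agree = link (subst (λ x → Chain σ′ x xs b) (sym (agree (here refl))) (chain-agree p (agree ∘ there)))

  chain-successor : ∀ {σ a b y ys x} → Chain σ a (y ∷ ys) b → x ∈ y ∷ ys → σ x ≡ b ⊎ σ x ∈ ys
  chain-successor (link [])         (here refl)  = inj₁ refl
  chain-successor (link (link p))   (here refl)  = inj₂ (here refl)
  chain-successor (link p@(link _)) (there x∈ys) with chain-successor p x∈ys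
  ... | inj₁ e = inj₁ e
  ... | inj₂ m = inj₂ (there m)

  orbit-closed : ∀ {σ i p x} → IsOrbit σ i p → x ∈ i ∷ p → σ x ∈ i ∷ p
  orbit-closed (ch , _) x∈ with chain-successor (link ch) x∈
  ... | inj₁ e = here e
  ... | inj₂ m = there m

  Unique-resp-↭ : ∀ {xs ys : List (Fin N)} → xs ↭ ys → Unique xs → Unique ys
  Unique-resp-↭ xs↭ys = SetoidPerm.Unique-resp-↭ (setoid (Fin N)) (↭⇒↭ₛ xs↭ys)

  rotate : ∀ {σ a p i} → IsOrbit σ a p → i ∈ a ∷ p → ∃ λ p′ → IsOrbit σ i p′ × (a ∷ p) ↭ (i ∷ p′)
  rotate {p = p} o (here refl) = p , o , ↭-refl
  rotate {a = a} {i = i} (ch , un) (there i∈p) with ∈-∃++ i∈p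
  ... | xs , zs , refl with chain-split xs ch
  ...   | to-i , from-i = zs ++ a ∷ xs , (chain-++ from-i (link to-i) , Unique-resp-↭ perm un) , perm
    where perm = ++-comm (a ∷ xs) (i ∷ zs)

  chain-last : ∀ {σ a b x xs} → Chain σ a (x ∷ xs) b → ∃ λ z → z ∈ x ∷ xs × σ z ≡ b
  chain-last (link [])         = _ , here refl , refl
  chain-last (link p@(link _)) with chain-last p
  ... | z , z∈ , e = z , there z∈ , e

  orbit-predecessor : ∀ {σ i p y} → IsOrbit σ i p → y ∈ i ∷ p → ∃ λ z → z ∈ i ∷ p × σ z ≡ y
  orbit-predecessor o y∈ with rotate o y∈
  ... | p′ , (ch , _) , perm with chain-last (link ch)
  ...   | z , z∈ , e = z , ∈-resp-↭ (↭-sym perm) z∈ , e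

  unique⇒length≤ : ∀ {xs : List (Fin N)} → Unique xs → length xs ≤ N
  unique⇒length≤ un = Fin.injective⇒≤ (lookup-injective un)

  covering⇒≤length : ∀ {xs : List (Fin N)} → (∀ v → v ∈ xs) → N ≤ length xs
  covering⇒≤length {xs} all = Fin.injective⇒≤ λ {v} {v′} e →
    trans (lookup-index (all v)) (trans (cong (lookup xs) e) (sym (lookup-index (all v′))))

  fresh-∷ : ∀ {x} {xs : List (Fin N)} → x ∉ xs → Unique xs → Unique (x ∷ xs)
  fresh-∷ x∉ un = ¬Any⇒All¬ _ x∉ ∷ un

  module _ (π : Permutation′ N) where

    private
      σ = π ⟨$⟩ʳ_

    -- The cycle is traced backwards from j until its front a is σ j. As Z is closed under σ,
    -- preimages of elements outside Z stay outside. The entries of `j ∷ pre` are distinct, so the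
    -- fuel f cannot run out.
    orbit-avoiding : ∀ {Z} → (∀ {x} → x ∈ Z → σ x ∈ Z) → ∀ j → j ∉ Z →
                     ∃ λ p → IsOrbit σ j p × All (_∉ Z) (j ∷ p)
    orbit-avoiding {Z} closed j j∉Z = grow N j [] [] [] (λ ()) [] j∉Z (m≤m+n N 0)
      where
      grow : ∀ f a pre → Chain σ a pre j → Unique pre → j ∉ pre → All (_∉ Z) pre → a ∉ Z →
             N ≤ f + length pre → ∃ λ p → IsOrbit σ j p × All (_∉ Z) (j ∷ p)
      grow f a pre ch un j∉pre pre∉Z a∉Z bound with a Fin.≟ σ j
      ... | yes refl = pre , (ch , fresh-∷ j∉pre un) , j∉Z ∷ pre∉Z
      grow zero a pre ch un j∉pre pre∉Z a∉Z bound | no a≢σj =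
        contradiction (≤-trans (unique⇒length≤ (fresh-∷ j∉pre un)) bound) (<-irrefl refl)
      grow (suc f) a pre ch un j∉pre pre∉Z a∉Z bound | no a≢σj =
        grow f a′ (a′ ∷ pre) (link (subst (λ x → Chain σ x pre j) (sym σa′≡a) ch)) (fresh-∷ (a′∉pre ch un j∉pre) un)
          j∉ (a′∉Z ∷ pre∉Z) a′∉Z (≤-trans bound (≤-reflexive (sym (+-suc f (length pre)))))
        where
        a′ = π ⟨$⟩ˡ a
        σa′≡a : σ a′ ≡ a
        σa′≡a = Perm.inverseʳ π
        a′∉Z : a′ ∉ Z
        a′∉Z a′∈Z = a∉Z (subst (_∈ Z) σa′≡a (closed a′∈Z))
        j∉ : j ∉ a′ ∷ pre
        j∉ (here refl) = a≢σj (sym σa′≡a)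
        j∉ (there m)   = j∉pre m
        a′∉pre : ∀ {xs} → Chain σ a xs j → Unique xs → j ∉ xs → a′ ∉ xs
        a′∉pre ch@(link _) un j∉ a′∈ with chain-successor ch a′∈
        ... | inj₁ e = j∉ (here (trans (sym e) σa′≡a))
        ... | inj₂ m = Unique[x∷xs]⇒x∉xs un (subst (_∈ _) σa′≡a m)

    -- After the exchange i is followed by σ j, whence p₂ leads to j; then j is followed by σ i,
    -- whence p₁ leads back to i.
    merge-orbits : ∀ {i j p₁ p₂} → IsOrbit σ i p₁ → IsOrbit σ j p₂ → All (_∉ i ∷ p₁) (j ∷ p₂) →
                   IsOrbit (swapAt i j π ⟨$⟩ʳ_) i (p₂ ++ j ∷ p₁)
    merge-orbits {i} {j} {p₁} {p₂} (ch₁ , un₁) (ch₂ , un₂) disj =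
      subst (λ x → Chain σ′ x (p₂ ++ j ∷ p₁) i) (sym (swapAt-i i j π))
        (chain-++ (chain-agree ch₂ agree₂) (link (subst (λ x → Chain σ′ x p₁ i) (sym (swapAt-j i j π)) (chain-agree ch₁ agree₁)))) ,
      Unique-resp-↭ perm (++⁺ un₂ un₁ λ (x∈₂ , x∈₁) → All.lookup disj x∈₂ x∈₁)
      where
      σ′ = swapAt i j π ⟨$⟩ʳ_
      agree₂ : ∀ {x} → x ∈ p₂ → σ′ x ≡ σ x
      agree₂ x∈ = swapAt-other i j π (λ { refl → All.lookup disj (there x∈) (here refl) }) (λ { refl → Unique[x∷xs]⇒x∉xs un₂ x∈ })
      agree₁ : ∀ {x} → x ∈ p₁ → σ′ x ≡ σ x
      agree₁ x∈ = swapAt-other i j π (λ { refl → Unique[x∷xs]⇒x∉xs un₁ x∈ }) (λ { refl → All.lookup disj (here refl) (there x∈) })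
      perm : (j ∷ p₂) ++ (i ∷ p₁) ↭ i ∷ p₂ ++ j ∷ p₁
      perm = ↭-trans (prep j (shift i p₂ p₁)) (↭-trans (swap j i ↭-refl) (prep i (↭-sym (shift j p₂ p₁))))

-- Iterates along a cycle

pow : ∀ {A : Set} → (A → A) → ℕ → A → A
pow σ zero    a = a
pow σ (suc t) a = pow σ t (σ a)

pow-suc : ∀ {A : Set} (σ : A → A) t a → pow σ (suc t) a ≡ σ (pow σ t a)
pow-suc σ zero    a = refl
pow-suc σ (suc t) a = pow-suc σ t (σ a)

pow-injective : ∀ {A : Set} {σ : A → A} → Injective _≡_ _≡_ σ → ∀ t → Injective _≡_ _≡_ (pow σ t)
pow-injective inj zero    e = e
pow-injective inj (suc t) e = inj (pow-injective inj t e)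

pow-∈ : ∀ {N} {σ : Fin N → Fin N} {a b xs} → Chain σ a xs b → ∀ t → t < length xs → pow σ t a ∈ xs
pow-∈ (link p) zero    _         = here refl
pow-∈ (link p) (suc t) (s≤s t<l) = there (pow-∈ p t t<l)

pow-distinct : ∀ {N} {σ : Fin N → Fin N} {a b xs} → Chain σ a xs b → Unique xs → ∀ s t → s < length xs → t < length xs →
               pow σ s a ≡ pow σ t a → s ≡ t
pow-distinct (link p) un       zero    zero    _ _ e = refl
pow-distinct (link p) un       zero    (suc t) _ (s≤s t<) e = contradiction (subst (_∈ _) (sym e) (pow-∈ p t t<)) (Unique[x∷xs]⇒x∉xs un)
pow-distinct (link p) un       (suc s) zero    (s≤s s<) _ e = contradiction (subst (_∈ _) e (pow-∈ p s s<)) (Unique[x∷xs]⇒x∉xs un)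
pow-distinct (link p) (_ ∷ un) (suc s) (suc t) (s≤s s<) (s≤s t<) e = cong suc (pow-distinct p un s t s< t< e)

-- The digraph of a perfect matching

-- Throughout, e i j is the colour of lᵢrⱼ, so e i i is the colour of tile i.
Arc : ∀ {n} → (Fin n → Fin n → ℕ) → Fin n → Fin n → Set
Arc e i j = e j i ≢ e i i × e j i ≢ e j j

-- A directed cycle through i₀ with k + 1 distinct tiles. Indexing τ by ℕ keeps modular arithmetic
-- out of the digraph argument.
record ClosedWalk {n : ℕ} (e : Fin n → Fin n → ℕ) (i₀ : Fin n) (k : ℕ) : Set where
  field
    τ        : ℕ → Fin n
    τ-zero   : τ 0 ≡ i₀
    τ-closed : τ (suc k) ≡ i₀
    τ-inj    : ∀ s t → s ≤ k → t ≤ k → τ s ≡ τ t → s ≡ t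
    τ-arc    : ∀ t → t ≤ k → Arc e (τ t) (τ (suc t))

-- u and w flag the tiles that are large at their right and left end, respectively.
record Tiling {n : ℕ} (e : Fin n → Fin n → ℕ) (u w : Fin n → ℕ) (A K h : ℕ) : Set where
  field
    disjoint : ∀ i → u i ≡ 0 ⊎ w i ≡ 0
    outClass : ∀ i → ∑ (λ j → δ (e j i) (e i i)) ≤ A
    outSmall : ∀ i → u i ≡ 0 → ∑ (λ j → δ (e j i) (e i i)) ≤ K
    inClass  : ∀ j → ∑ (λ i → δ (e j i) (e j j)) ≤ A
    inSmall  : ∀ j → w j ≡ 0 → ∑ (λ i → δ (e j i) (e j j)) ≤ K
    outPop   : ∀ i → ∑ (λ j → (1 ∸ w j) * δ (e j i) (e j j)) ≤ h
    inPop    : ∀ j → ∑ (λ i → (1 ∸ u i) * δ (e j i) (e i i)) ≤ h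

-- Omitting tile zero only lowers the sums. The Hamilton cycle is built on the remaining tiles.
restrict : ∀ {n e u w A K h} → Tiling {suc n} e u w A K h → Tiling {n} (λ i j → e (suc i) (suc j)) (u ∘ suc) (w ∘ suc) A K h
restrict T = record
  { disjoint = disjoint ∘ suc
  ; outClass = λ i → ≤-trans (m≤n+m _ _) (outClass (suc i))
  ; outSmall = λ i ui → ≤-trans (m≤n+m _ _) (outSmall (suc i) ui)
  ; inClass  = λ i → ≤-trans (m≤n+m _ _) (inClass (suc i))
  ; inSmall  = λ i wi → ≤-trans (m≤n+m _ _) (inSmall (suc i) wi)
  ; outPop   = λ i → ≤-trans (m≤n+m _ _) (outPop (suc i))
  ; inPop    = λ i → ≤-trans (m≤n+m _ _) (inPop (suc i))
  } where open Tiling T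

module TilingProperties {N : ℕ} {e : Fin N → Fin N → ℕ} {u w : Fin N → ℕ} {A K h : ℕ} (T : Tiling e u w A K h) where

  open Tiling T
  open import Data.List.Membership.DecPropositional (Fin._≟_ {N}) using (_∈?_)

  X = ∑ w
  Y = ∑ u

  -- Counts the clashes that destroy i → j: with tile i at rᵢ and with tile j at lⱼ.
  lost : Fin N → Fin N → ℕ
  lost i j = δ (e j i) (e i i) + δ (e j i) (e j j)

  lost≡0⇒arc : ∀ i j → lost i j ≡ 0 → Arc e i j
  lost≡0⇒arc i j l≡0 = ind≡0⇒¬ (e j i ≟ℕ e i i) (m+n≡0⇒m≡0 _ l≡0) , ind≡0⇒¬ (e j i ≟ℕ e j j) (m+n≡0⇒n≡0 (δ (e j i) (e i i)) l≡0)

  ≤-flag : ∀ x d → d ≤ 1 → d ≤ x + (1 ∸ x) * d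
  ≤-flag zero    d d≤1 = ≤-reflexive (sym (+-identityʳ d))
  ≤-flag (suc x) d d≤1 = ≤-trans d≤1 (s≤s z≤n)

  -- Flagged tiles are counted trivially; only the unflagged ones need the popularity bound h.
  ∑-flag : ∀ (x d : Fin N → ℕ) → (∀ i → d i ≤ 1) → ∀ {h} → ∑ (λ i → (1 ∸ x i) * d i) ≤ h → ∑ d ≤ ∑ x + h
  ∑-flag x d d≤1 {h} ≤h = begin
    ∑ d                                 ≤⟨ ∑-mono (λ i → ≤-flag (x i) (d i) (d≤1 i)) ⟩
    ∑ (λ i → x i + (1 ∸ x i) * d i)     ≡⟨ ∑-distrib-+ x (λ i → (1 ∸ x i) * d i) ⟩
    ∑ x + ∑ (λ i → (1 ∸ x i) * d i)     ≤⟨ +-monoʳ-≤ (∑ x) ≤h ⟩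
    ∑ x + h                             ∎
    where open ≤-Reasoning

  -- Clashes at rᵢ come from one colour class. A clash at lⱼ means that tile j is large there, which
  -- X counts, or that it contributes to the popularity of rᵢ.
  row-bound : ∀ i {B} → ∑ (λ j → δ (e j i) (e i i)) ≤ B → ∑ (lost i) ≤ B + (X + h)
  row-bound i {B} ≤B = begin
    ∑ (lost i)                                                    ≡⟨ ∑-distrib-+ (λ j → δ (e j i) (e i i)) (λ j → δ (e j i) (e j j)) ⟩
    ∑ (λ j → δ (e j i) (e i i)) + ∑ (λ j → δ (e j i) (e j j))     ≤⟨ +-mono-≤ ≤B (∑-flag w _ (λ j → ind≤1 (e j i ≟ℕ e j j)) (outPop i)) ⟩
    B + (X + h)                                                   ∎
    where open ≤-Reasoning

  col-bound : ∀ j {B} → ∑ (λ i → δ (e j i) (e j j)) ≤ B → ∑ (λ i → lost i j) ≤ (Y + h) + B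
  col-bound j {B} ≤B = begin
    ∑ (λ i → lost i j)                                            ≡⟨ ∑-distrib-+ (λ i → δ (e j i) (e i i)) (λ i → δ (e j i) (e j j)) ⟩
    ∑ (λ i → δ (e j i) (e i i)) + ∑ (λ i → δ (e j i) (e j j))     ≤⟨ +-mono-≤ (∑-flag u _ (λ i → ind≤1 (e j i ≟ℕ e i i)) (inPop j)) ≤B ⟩
    (Y + h) + B                                                   ∎
    where open ≤-Reasoning

  -- Smallness at one of the two ends replaces one of the two bounds A by K. The slack 2h + 2K is
  -- added so that one size hypothesis also covers the count in `find`.
  row+col : ∀ i k → u i ≡ 0 ⊎ w k ≡ 0 → ∑ (lost i) + ∑ (λ j → lost j k) ≤ Y + X + A + 4 * h + 3 * K
  row+col i k (inj₁ ui≡0) = ≤-trans (+-mono-≤ (row-bound i (outSmall i ui≡0)) (col-bound k (inClass k))) (≤-trans (m≤m+n _ (2 * h + 2 * K)) (≤-reflexive (arith X Y A h K)))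
    where arith : ∀ X Y A h K → K + (X + h) + (Y + h + A) + (2 * h + 2 * K) ≡ Y + X + A + 4 * h + 3 * K
          arith = solve-∀
  row+col i k (inj₂ wk≡0) = ≤-trans (+-mono-≤ (row-bound i (outClass i)) (col-bound k (inSmall k wk≡0))) (≤-trans (m≤m+n _ (2 * h + 2 * K)) (≤-reflexive (arith X Y A h K)))
    where arith : ∀ X Y A h K → A + (X + h) + (Y + h + K) + (2 * h + 2 * K) ≡ Y + X + A + 4 * h + 3 * K
          arith = solve-∀

  module _ (size : Y + X + A + 4 * h + 3 * K < N) where

    oneFactor : ∃ λ (π : Permutation′ N) → ∀ i → Arc e i (π ⟨$⟩ʳ i)
    oneFactor = Repair.repair (Arc e) (λ i k → u i ≡ 0 ⊎ w k ≡ 0) fix Perm.id (inj₂ ∘ disjoint)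
      where
      fix : ∀ (π : Permutation′ N) i → u i ≡ 0 ⊎ w (π ⟨$⟩ʳ i) ≡ 0 →
            ∃ λ j → Arc e i (π ⟨$⟩ʳ j) × Arc e j (π ⟨$⟩ʳ i)
      -- j fails only if i → π j or j → π i is missing; over all j this amounts to one row and one
      -- column of `lost`.
      fix π i fixable with ∑<n⇒zero (λ j → lost i (π ⟨$⟩ʳ j) + lost j (π ⟨$⟩ʳ i)) bound
        where
        open ≤-Reasoning
        bound : ∑ (λ j → lost i (π ⟨$⟩ʳ j) + lost j (π ⟨$⟩ʳ i)) < N
        bound = begin-strict
          ∑ (λ j → lost i (π ⟨$⟩ʳ j) + lost j (π ⟨$⟩ʳ i))               ≡⟨ ∑-distrib-+ (λ j → lost i (π ⟨$⟩ʳ j)) (λ j → lost j (π ⟨$⟩ʳ i)) ⟩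
          ∑ (λ j → lost i (π ⟨$⟩ʳ j)) + ∑ (λ j → lost j (π ⟨$⟩ʳ i))     ≤⟨ +-monoˡ-≤ _ (∑-inj (perm-injective π) (lost i)) ⟩
          ∑ (lost i) + ∑ (λ j → lost j (π ⟨$⟩ʳ i))                      ≤⟨ row+col i (π ⟨$⟩ʳ i) fixable ⟩
          Y + X + A + 4 * h + 3 * K                                     <⟨ size ⟩
          N                                                             ∎
      ... | j , l≡0 = j , lost≡0⇒arc i _ (m+n≡0⇒m≡0 _ l≡0) , lost≡0⇒arc j _ (m+n≡0⇒n≡0 (lost i (π ⟨$⟩ʳ j)) l≡0)

    -- Merging the cycles of a one-factor

    module _ (π : Permutation′ N) where

      private
        σ = π ⟨$⟩ʳ_

      -- The edge of the arc i → σ i meets tile i at its right end and tile σ i at its left end.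
      -- These two ends are required to be small.
      GoodArc : Fin N → Set
      GoodArc i = u i ≡ 0 × w (σ i) ≡ 0

      SemiGoodArc : Fin N → Set
      SemiGoodArc j = u j ≡ 0 ⊎ w (σ j) ≡ 0

      Exchangeable : Fin N → Fin N → Set
      Exchangeable i j = Arc e i (σ j) × Arc e j (σ i)

      -- The four possible clashes of the new arcs i → σ j and j → σ i. The factors `1 ∸ u i` and
      -- `1 ∸ w (σ i)` are 1 on good arcs i, and they let the sum over i be bounded by popularities,
      -- without the terms X and Y.
      clash : Fin N → Fin N → ℕ
      clash j i = (1 ∸ u i) * δ (e (σ j) i) (e i i) + δ (e (σ j) i) (e (σ j) (σ j))
                + (δ (e (σ i) j) (e j j) + (1 ∸ w (σ i)) * δ (e (σ i) j) (e (σ i) (σ i)))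

      clash≡0⇒exchangeable : ∀ i j → GoodArc i → clash j i ≡ 0 → Exchangeable i j
      clash≡0⇒exchangeable i j (ui , wi) cl rewrite ui | wi =
        lost≡0⇒arc i (σ j) (trans (cong (_+ δ (e (σ j) i) (e (σ j) (σ j))) (sym (+-identityʳ _))) (m+n≡0⇒m≡0 _ cl)) ,
        lost≡0⇒arc j (σ i) (trans (cong (δ (e (σ i) j) (e j j) +_) (sym (+-identityʳ _))) (m+n≡0⇒n≡0 (δ (e (σ j) i) (e i i) + 0 + δ (e (σ j) i) (e (σ j) (σ j))) cl))

      clash-bound : ∀ j {B C} → ∑ (λ i → δ (e (σ j) i) (e (σ j) (σ j))) ≤ B → ∑ (λ i → δ (e i j) (e j j)) ≤ C →
                    ∑ (clash j) ≤ h + B + (C + h)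
      clash-bound j {B} {C} ≤B ≤C = begin
        ∑ (clash j)                               ≡⟨ ∑-distrib-+ (λ i → a i + b i) (λ i → c (σ i) + d (σ i)) ⟩
        ∑ (λ i → a i + b i) + ∑ (λ i → c (σ i) + d (σ i)) ≡⟨ cong₂ _+_ (∑-distrib-+ a b) (∑-distrib-+ (c ∘ σ) (d ∘ σ)) ⟩
        ∑ a + ∑ b + (∑ (c ∘ σ) + ∑ (d ∘ σ))       ≤⟨ +-mono-≤ (+-mono-≤ (inPop (σ j)) ≤B) (+-mono-≤ (≤-trans (∑-inj (perm-injective π) c) ≤C) (≤-trans (∑-inj (perm-injective π) d) (outPop j))) ⟩
        h + B + (C + h)                           ∎
        where
        open ≤-Reasoning
        a b c d : Fin N → ℕ
        a i = (1 ∸ u i) * δ (e (σ j) i) (e i i)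
        b i = δ (e (σ j) i) (e (σ j) (σ j))
        c k = δ (e k j) (e j j)
        d k = (1 ∸ w k) * δ (e k j) (e k k)

      clash-semi : ∀ j → SemiGoodArc j → ∑ (clash j) ≤ A + K + 2 * h
      clash-semi j (inj₁ uj) = ≤-trans (clash-bound j (inClass (σ j)) (outSmall j uj)) (≤-reflexive (arith A K h))
        where arith : ∀ A K h → h + A + (K + h) ≡ A + K + 2 * h
              arith = solve-∀
      clash-semi j (inj₂ wj) = ≤-trans (clash-bound j (inSmall (σ j) wj) (outClass j)) (≤-reflexive (arith A K h))
        where arith : ∀ A K h → h + K + (A + h) ≡ A + K + 2 * h
              arith = solve-∀

      clash-good : ∀ j → GoodArc j → ∑ (clash j) ≤ 2 * K + 2 * h
      clash-good j (uj , wj) = ≤-trans (clash-bound j (inSmall (σ j) wj) (outSmall j uj)) (≤-reflexive (arith K h))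
        where arith : ∀ K h → h + K + (K + h) ≡ 2 * K + 2 * h
              arith = solve-∀

      -- At most Y + X indices fail to be good arcs. The allowance for f covers one semi-good and
      -- one good exchange partner at once.
      find : ∀ (f : Fin N → ℕ) → ∑ f ≤ A + K + 2 * h + (2 * K + 2 * h) → ∃ λ i → GoodArc i × f i ≡ 0
      find f f≤ with ∑<n⇒zero (λ i → u i + w (σ i) + f i) bound
        where
        open ≤-Reasoning
        arith : ∀ Y X A K h → Y + X + (A + K + 2 * h + (2 * K + 2 * h)) ≡ Y + X + A + 4 * h + 3 * K
        arith = solve-∀
        bound : ∑ (λ i → u i + w (σ i) + f i) < N
        bound = begin-strict
          ∑ (λ i → u i + w (σ i) + f i)                 ≡⟨ ∑-distrib-+ (λ i → u i + w (σ i)) f ⟩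
          ∑ (λ i → u i + w (σ i)) + ∑ f                 ≡⟨ cong (_+ ∑ f) (∑-distrib-+ u (w ∘ σ)) ⟩
          Y + ∑ (w ∘ σ) + ∑ f                           ≤⟨ +-mono-≤ (+-monoʳ-≤ Y (∑-inj (perm-injective π) w)) f≤ ⟩
          Y + X + (A + K + 2 * h + (2 * K + 2 * h))     ≡⟨ arith Y X A K h ⟩
          Y + X + A + 4 * h + 3 * K                     <⟨ size ⟩
          N                                             ∎
      ... | i , z = i , (m+n≡0⇒m≡0 _ uw , m+n≡0⇒n≡0 (u i) uw) , m+n≡0⇒n≡0 (u i + w (σ i)) z
        where uw = m+n≡0⇒m≡0 (u i + w (σ i)) z

      -- Two consecutive arcs v → σ v → σ (σ v) cannot both be bad at both ends, since no tile is.
      semiGood : ∀ {Q : Fin N → Set} → (∀ {x} → Q x → Q (σ x)) → ∀ v → Q v → ∃ λ j → Q j × SemiGoodArc j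
      semiGood closed v q with disjoint (σ v)
      ... | inj₁ u≡0 = σ v , closed q , inj₁ u≡0
      ... | inj₂ w≡0 = v , q , inj₂ w≡0

      -- If no arc outside Z is good, a good i exchangeable with a semi-good j outside must lie in
      -- Z. Otherwise take a good j outside and a semi-good j₀ inside, and a good i exchangeable
      -- with both: wherever i lies, one of the two exchanges crosses between Z and its complement.
      exchange : ∀ {Z} → (∀ {x} → x ∈ Z → σ x ∈ Z) → (∀ {x} → x ∉ Z → σ x ∉ Z) → ∀ a v → a ∈ Z → v ∉ Z →
                 ∃₂ λ i j → i ∈ Z × j ∉ Z × Exchangeable i j
      exchange {Z} closed coclosed a v a∈ v∉ = cases (Fin.any? (λ j → ¬? (j ∈? Z) ×-dec ((u j ≟ℕ 0) ×-dec (w (σ j) ≟ℕ 0))))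
        where
        Goal = ∃₂ λ i j → i ∈ Z × j ∉ Z × Exchangeable i j
        pick : ∀ j₀ j i → j₀ ∈ Z → j ∉ Z → Exchangeable i j₀ → Exchangeable i j → Dec (i ∈ Z) → Goal
        pick j₀ j i j₀∈ j∉ _       ij (yes i∈) = i , j , i∈ , j∉ , ij
        pick j₀ j i j₀∈ j∉ (x , y) _  (no i∉)  = j₀ , i , j₀∈ , i∉ , y , x
        cases : Dec (∃ λ j → j ∉ Z × GoodArc j) → Goal
        cases (no none) =
          let j , j∉ , semi = semiGood {_∉ Z} coclosed v v∉
              i , good , cl = find (clash j) (≤-trans (clash-semi j semi) (m≤m+n _ _))
          in i , j , decidable-stable (i ∈? Z) (λ i∉ → none (i , i∉ , good)) , j∉ , clash≡0⇒exchangeable i j good cl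
        cases (yes (j , j∉ , goodj)) =
          let j₀ , j₀∈ , semi = semiGood {_∈ Z} closed a a∈
              i , good , cl = find (λ i → clash j₀ i + clash j i)
                (≤-trans (≤-reflexive (∑-distrib-+ (clash j₀) (clash j))) (+-mono-≤ (clash-semi j₀ semi) (clash-good j goodj)))
          in pick j₀ j i j₀∈ j∉ (clash≡0⇒exchangeable i j₀ good (m+n≡0⇒m≡0 (clash j₀ i) cl))
               (clash≡0⇒exchangeable i j good (m+n≡0⇒n≡0 (clash j₀ i) cl)) (i ∈? Z)

    hamiltonian : ∃ λ (π : Permutation′ N) → (∀ i → Arc e i (π ⟨$⟩ʳ i)) ×
                  ∀ a → ∃ λ p → IsOrbit (π ⟨$⟩ʳ_) a p × (N ≤ length (a ∷ p))
    hamiltonian =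
      let π₀ , arcs₀  = oneFactor
          p₀ , o₀ , _ = orbit-avoiding π₀ {[]} (λ ()) (fromℕ< size) (λ ())
      in grow N π₀ arcs₀ (fromℕ< size) p₀ o₀ (m≤m+n N _)
      where
      Result = ∃ λ (π : Permutation′ N) → (∀ i → Arc e i (π ⟨$⟩ʳ i)) × ∀ a → ∃ λ p → IsOrbit (π ⟨$⟩ʳ_) a p × (N ≤ length (a ∷ p))

      -- Each merge strictly lengthens the current orbit, so the fuel f bounds the number of merges.
      -- Once the orbit covers all tiles, rotating it gives the orbit of every tile.
      grow : ∀ f π → (∀ i → Arc e i (π ⟨$⟩ʳ i)) → ∀ a p → IsOrbit (π ⟨$⟩ʳ_) a p → N ≤ f + length p → Result
      grow f π arcs a p o bound = cases f bound (Fin.any? (λ v → ¬? (v ∈? (a ∷ p))))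
        where
        coclosed : ∀ {x} → x ∉ a ∷ p → π ⟨$⟩ʳ x ∉ a ∷ p
        coclosed x∉ σx∈ =
          let z , z∈ , eq = orbit-predecessor o σx∈ in x∉ (subst (_∈ a ∷ p) (perm-injective π eq) z∈)
        cases : ∀ f → N ≤ f + length p → Dec (∃ λ v → v ∉ a ∷ p) → Result
        cases f bound (no none) = π , arcs , λ b →
          let p′ , o′ , perm = rotate o (cover b)
          in p′ , o′ , ≤-trans (covering⇒≤length cover) (≤-reflexive (↭-length perm))
          where
          cover : ∀ b → b ∈ a ∷ p
          cover b = decidable-stable (b ∈? (a ∷ p)) λ b∉ → none (b , b∉)
        cases zero bound (yes _) = contradiction (≤-trans (unique⇒length≤ (proj₂ o)) bound) (<-irrefl refl)
        cases (suc f) bound (yes (v , v∉)) =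
          let i , j , i∈ , j∉ , arc-i , arc-j = exchange π (orbit-closed o) coclosed a v (here refl) v∉
              p₁ , o₁ , perm = rotate o i∈
              p₂ , o₂ , avoid = orbit-avoiding π (orbit-closed o) j j∉
          in grow f (swapAt i j π) (λ k → swapAt-elim (Arc e) i j π arc-i arc-j (arcs k)) i (p₂ ++ j ∷ p₁)
               (merge-orbits π o₁ o₂ (All.map (λ x∉ x∈ → x∉ (∈-resp-↭ (↭-sym perm) x∈)) avoid))
               (longer i j p₁ p₂ (↭-length perm))
          where
          open ≤-Reasoning
          longer : ∀ i j p₁ p₂ → length (a ∷ p) ≡ length (i ∷ p₁) → N ≤ f + length (p₂ ++ j ∷ p₁)
          longer i j p₁ p₂ eq = begin
            N                                 ≤⟨ bound ⟩
            suc (f + length p)                ≡⟨ sym (+-suc f (length p)) ⟩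
            f + length (a ∷ p)                ≡⟨ cong (f +_) eq ⟩
            f + length (i ∷ p₁)               ≤⟨ +-monoʳ-≤ f (m≤n+m _ (length p₂)) ⟩
            f + (length p₂ + length (j ∷ p₁)) ≡⟨ cong (f +_) (sym (length-++ p₂)) ⟩
            f + length (p₂ ++ j ∷ p₁)         ∎

-- Inserting the tile zero into a Hamilton cycle

module _ {N : ℕ} {e : Fin (suc N) → Fin (suc N) → ℕ} {u w : Fin (suc N) → ℕ} {A K h : ℕ} (T : Tiling e u w A K h)
  (size : ∑ u + ∑ w + A + 4 * h + 3 * K < N) where

  private
    module T = TilingProperties T
    module R = TilingProperties (restrict T)

  size-restrict : R.Y + R.X + A + 4 * h + 3 * K < N
  size-restrict = ≤-<-trans (+-monoˡ-≤ (3 * K) (+-monoˡ-≤ (4 * h) (+-monoˡ-≤ A (+-mono-≤ (m≤n+m R.Y (u zero)) (m≤n+m R.X (w zero)))))) size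

  -- The k + 1 consecutive tiles v, σ v, ..., σᵏ v of the Hamilton cycle are closed up through tile
  -- zero, which gives k + 2 tiles. As σᵏ is injective, the forbidden v are bounded by the row plus
  -- the column of tile zero.
  closedWalk : ∀ k → k < N → ClosedWalk e zero (suc k)
  closedWalk k k<N =
    let π , arcs , orbits = R.hamiltonian size-restrict
        v , l≡0           = ∑<n⇒zero _ (bound π)
        p , (ch , un) , N≤len = orbits v
    in walk π arcs v p ch un N≤len (m+n≡0⇒m≡0 _ l≡0) (m+n≡0⇒n≡0 (T.lost zero (suc v)) l≡0)
    where
    bound : ∀ (π : Permutation′ N) → ∑ (λ v → T.lost zero (suc v) + T.lost (suc (pow (π ⟨$⟩ʳ_) k v)) zero) < N
    bound π = begin-strict
      ∑ (λ v → T.lost zero (suc v) + T.lost (suc (pow σ k v)) zero)               ≡⟨ ∑-distrib-+ (λ v → T.lost zero (suc v)) (λ v → T.lost (suc (pow σ k v)) zero) ⟩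
      ∑ (λ v → T.lost zero (suc v)) + ∑ (λ v → T.lost (suc (pow σ k v)) zero)     ≤⟨ +-mono-≤ (m≤n+m _ (T.lost zero zero)) (∑-inj (pow-injective (perm-injective π) k) (λ v → T.lost (suc v) zero)) ⟩
      ∑ (T.lost zero) + ∑ (λ v → T.lost (suc v) zero)                             ≤⟨ +-monoʳ-≤ (∑ (T.lost zero)) (m≤n+m _ (T.lost zero zero)) ⟩
      ∑ (T.lost zero) + ∑ (λ v → T.lost v zero)                                   ≤⟨ T.row+col zero zero (Tiling.disjoint T zero) ⟩
      ∑ u + ∑ w + A + 4 * h + 3 * K                                               <⟨ size ⟩
      N                                                                           ∎
      where
      open ≤-Reasoning
      σ = π ⟨$⟩ʳ_
    walk : ∀ (π : Permutation′ N) → (∀ i → Arc (λ i j → e (suc i) (suc j)) i (π ⟨$⟩ʳ i)) → ∀ v p →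
           Chain (π ⟨$⟩ʳ_) (π ⟨$⟩ʳ v) p v → Unique (v ∷ p) → N ≤ length (v ∷ p) →
           T.lost zero (suc v) ≡ 0 → T.lost (suc (pow (π ⟨$⟩ʳ_) k v)) zero ≡ 0 → ClosedWalk e zero (suc k)
    walk π arcs v p ch un N≤len out≡0 in≡0 = record { τ = τ ; τ-zero = refl ; τ-closed = τ-end ; τ-inj = inj ; τ-arc = arc }
     where
     σ = π ⟨$⟩ʳ_
     -- The default value beyond index k is tile zero itself, which closes the walk.
     τ-suc : ∀ t → Dec (t ≤ k) → Fin (suc N)
     τ-suc t (yes _) = suc (pow σ t v)
     τ-suc t (no _)  = zero
     τ : ℕ → Fin (suc N)
     τ zero    = zero
     τ (suc t) = τ-suc t (t ≤? k)
     τ-in : ∀ t → t ≤ k → τ (suc t) ≡ suc (pow σ t v)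
     τ-in t t≤k with t ≤? k
     ... | yes _  = refl
     ... | no t≰k = contradiction t≤k t≰k
     τ-end : τ (suc (suc k)) ≡ zero
     τ-end with suc k ≤? k
     ... | yes k<k = contradiction k<k (<-irrefl refl)
     ... | no _    = refl
     inside : ∀ {t} → t ≤ k → t < length (v ∷ p)
     inside t≤k = ≤-trans (s≤s t≤k) (≤-trans k<N N≤len)
     inj : ∀ s t → s ≤ suc k → t ≤ suc k → τ s ≡ τ t → s ≡ t
     inj zero    zero    _ _ _ = refl
     inj zero    (suc t) _ (s≤s t≤k) eq with trans eq (τ-in t t≤k)
     ... | ()
     inj (suc s) zero    (s≤s s≤k) _ eq with trans (sym eq) (τ-in s s≤k)
     ... | ()
     inj (suc s) (suc t) (s≤s s≤k) (s≤s t≤k) eq = cong suc (pow-distinct (link ch) un s t (inside s≤k) (inside t≤k)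
       (Fin.suc-injective (trans (sym (τ-in s s≤k)) (trans eq (τ-in t t≤k)))))
     arc : ∀ t → t ≤ suc k → Arc e (τ t) (τ (suc t))
     arc zero    _ = subst (Arc e zero) (sym (τ-in 0 z≤n)) (T.lost≡0⇒arc zero (suc v) out≡0)
     arc (suc t) (s≤s t≤k) with m≤n⇒m<n∨m≡n t≤k
     ... | inj₁ t<k  = subst₂ (Arc e) (sym (τ-in t t≤k)) (sym (trans (τ-in (suc t) t<k) (cong suc (pow-suc σ t v)))) (arcs (pow σ t v))
     ... | inj₂ refl = subst₂ (Arc e) (sym (τ-in t t≤k)) (sym τ-end) (T.lost≡0⇒arc _ zero in≡0)

-- Sums and squares under an exchange

-- With p′ = p + x - y one has p′² = p² + 2p(x - y) + (x - y)², and (x - y)² ≤ 2|x - y| ≤ 2(x + y)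
-- because x and y are at most 2. Negative terms are moved across to stay within ℕ.
square-change : ∀ p p′ x y → p′ + y ≡ p + x → x ≤ 2 → y ≤ 2 → p′ * p′ + 2 * (p * y) ≤ p * p + 2 * (p * x) + 2 * (x + y)
square-change p p′ x y eq x≤2 y≤2 with ≤-total y x
... | inj₁ y≤x with m≤n⇒∃[o]m+o≡n y≤x
...   | t , refl with +-cancelʳ-≡ y p′ (p + t) (trans eq (trans (cong (p +_) (+-comm y t)) (sym (+-assoc p t y))))
...     | refl = begin
  (p + t) * (p + t) + 2 * (p * y)                  ≡⟨ lhs p t y ⟩
  p * p + 2 * (p * (y + t)) + t * t                ≤⟨ +-monoʳ-≤ (p * p + 2 * (p * (y + t))) (≤-trans (*-monoˡ-≤ t (≤-trans (m≤n+m t y) x≤2)) (*-monoʳ-≤ 2 (≤-trans (m≤n+m t y) (m≤m+n (y + t) y)))) ⟩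
  p * p + 2 * (p * (y + t)) + 2 * (y + t + y)      ∎
  where
  open ≤-Reasoning
  lhs : ∀ p t y → (p + t) * (p + t) + 2 * (p * y) ≡ p * p + 2 * (p * (y + t)) + t * t
  lhs = solve-∀
square-change p p′ x y eq x≤2 y≤2 | inj₂ x≤y with m≤n⇒∃[o]m+o≡n x≤y
...   | t , refl with +-cancelʳ-≡ x (p′ + t) p (trans (+-assoc p′ t x) (trans (cong (p′ +_) (+-comm t x)) eq))
...     | refl = +-cancelʳ-≤ (t * t) _ _ (begin
  p′ * p′ + 2 * ((p′ + t) * (x + t)) + t * t                                        ≡⟨ lhs p′ t x ⟩
  (p′ + t) * (p′ + t) + 2 * ((p′ + t) * x) + (t * t + t * t)                        ≤⟨ +-monoʳ-≤ ((p′ + t) * (p′ + t) + 2 * ((p′ + t) * x)) (+-monoˡ-≤ (t * t) tt≤) ⟩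
  (p′ + t) * (p′ + t) + 2 * ((p′ + t) * x) + (2 * (x + (x + t)) + t * t)            ≡⟨ sym (+-assoc ((p′ + t) * (p′ + t) + 2 * ((p′ + t) * x)) (2 * (x + (x + t))) (t * t)) ⟩
  (p′ + t) * (p′ + t) + 2 * ((p′ + t) * x) + 2 * (x + (x + t)) + t * t              ∎)
  where
  open ≤-Reasoning
  lhs : ∀ p t x → p * p + 2 * ((p + t) * (x + t)) + t * t ≡ (p + t) * (p + t) + 2 * ((p + t) * x) + (t * t + t * t)
  lhs = solve-∀
  tt≤ : t * t ≤ 2 * (x + (x + t))
  tt≤ = ≤-trans (*-monoˡ-≤ t (≤-trans (m≤n+m t x) y≤2)) (*-monoʳ-≤ 2 (≤-trans (m≤n+m t x) (m≤n+m (x + t) x)))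

∑∑ : ∀ {m n} → (Fin m → Fin n → ℕ) → ℕ
∑∑ f = ∑ λ i → ∑ (f i)

∑∑-mono : ∀ {m n} {f g : Fin m → Fin n → ℕ} → (∀ i j → f i j ≤ g i j) → ∑∑ f ≤ ∑∑ g
∑∑-mono p = ∑-mono λ i → ∑-mono (p i)

∑∑-+ : ∀ {m n} (f g : Fin m → Fin n → ℕ) → ∑∑ (λ i j → f i j + g i j) ≡ ∑∑ f + ∑∑ g
∑∑-+ f g = trans (sum-cong-≗ λ i → ∑-distrib-+ (f i) (g i)) (∑-distrib-+ (λ i → ∑ (f i)) (λ i → ∑ (g i)))

∑∑-* : ∀ {m n} k (f : Fin m → Fin n → ℕ) → ∑∑ (λ i j → k * f i j) ≡ k * ∑∑ f
∑∑-* k f = sym (trans (*-distribˡ-sum k (λ i → ∑ (f i))) (sum-cong-≗ λ i → *-distribˡ-sum k (f i)))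

∑∑-bound : ∀ {m n} {f : Fin m → Fin n → ℕ} k → (∀ i j → f i j ≤ k) → ∑∑ f ≤ m * (n * k)
∑∑-bound {n = n} k p = ∑-bound (n * k) λ i → ∑-bound k (p i)

∑∑∑-comm : ∀ {l m n} (f : Fin l → Fin m → Fin n → ℕ) → ∑∑ (λ i j → ∑ (λ z → f z i j)) ≡ ∑ (λ z → ∑∑ (f z))
∑∑∑-comm f = trans (sum-cong-≗ λ i → ∑-comm (λ j z → f z i j)) (∑-comm (λ i z → ∑ (f z i)))

stat : ∀ {n} → (Fin n → Fin n → ℕ) → Permutation′ n → ℕ
stat g π = ∑ λ i → g i (π ⟨$⟩ʳ i)

swapAt-same : ∀ {n} (i : Fin n) π k → swapAt i i π ⟨$⟩ʳ k ≡ π ⟨$⟩ʳ k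
swapAt-same i π k = swapAt-elim (λ k y → y ≡ π ⟨$⟩ʳ k) i i π refl refl {k} refl

-- The case i = j is included, so that the later average can run over all ordered pairs.
stat-swap : ∀ {n} (g : Fin n → Fin n → ℕ) i j π →
  stat g (swapAt i j π) + (g i (π ⟨$⟩ʳ i) + g j (π ⟨$⟩ʳ j)) ≡ stat g π + (g i (π ⟨$⟩ʳ j) + g j (π ⟨$⟩ʳ i))
stat-swap g i j π = cases (i Fin.≟ j)
  where
  open ≡-Reasoning
  σ = π ⟨$⟩ʳ_
  σ′ = swapAt i j π ⟨$⟩ʳ_
  at : Fin _ → ℕ → Fin _ → ℕ
  at i x k = ind (i Fin.≟ k) * x
  total : ∀ f x y → ∑ f + (x + y) ≡ ∑ (λ k → f k + (at i x k + at j y k))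
  total f x y = begin
    ∑ f + (x + y)                                ≡⟨ cong (∑ f +_) (sym (cong₂ _+_ (∑-pick i (λ _ → x)) (∑-pick j (λ _ → y)))) ⟩
    ∑ f + (∑ (at i x) + ∑ (at j y))              ≡⟨ cong (∑ f +_) (sym (∑-distrib-+ (at i x) (at j y))) ⟩
    ∑ f + ∑ (λ k → at i x k + at j y k)          ≡⟨ sym (∑-distrib-+ f (λ k → at i x k + at j y k)) ⟩
    ∑ (λ k → f k + (at i x k + at j y k))        ∎
  at-yes : ∀ i x → at i x i ≡ x
  at-yes i x = trans (cong (_* x) (ind-yes (i Fin.≟ i) refl)) (*-identityˡ x)
  at-no : ∀ i x k → i ≢ k → at i x k ≡ 0
  at-no i x k i≢k = cong (_* x) (ind-no (i Fin.≟ k) i≢k)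
  point : i ≢ j → ∀ k → Dec (k ≡ i) → Dec (k ≡ j) →
    g k (σ′ k) + (at i (g i (σ i)) k + at j (g j (σ j)) k) ≡ g k (σ k) + (at i (g i (σ j)) k + at j (g j (σ i)) k)
  point i≢j k (yes refl) _
    rewrite at-yes i (g i (σ i)) | at-yes i (g i (σ j)) | at-no j (g j (σ j)) i (i≢j ∘ sym) | at-no j (g j (σ i)) i (i≢j ∘ sym) | swapAt-i i j π
    | +-identityʳ (g i (σ i)) | +-identityʳ (g i (σ j)) = +-comm (g i (σ j)) (g i (σ i))
  point i≢j k (no _) (yes refl)
    rewrite at-no i (g i (σ i)) j i≢j | at-no i (g i (σ j)) j i≢j | at-yes j (g j (σ j)) | at-yes j (g j (σ i)) | swapAt-j i j π = +-comm (g j (σ i)) (g j (σ j))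
  point i≢j k (no k≢i) (no k≢j)
    rewrite at-no i (g i (σ i)) k (k≢i ∘ sym) | at-no i (g i (σ j)) k (k≢i ∘ sym) | at-no j (g j (σ j)) k (k≢j ∘ sym) | at-no j (g j (σ i)) k (k≢j ∘ sym)
    | swapAt-other i j π k≢i k≢j = refl
  cases : Dec (i ≡ j) → stat g (swapAt i j π) + (g i (σ i) + g j (σ j)) ≡ stat g π + (g i (σ j) + g j (σ i))
  cases (yes refl) = cong (_+ (g i (σ i) + g i (σ i))) (sum-cong-≗ λ k → cong (g k) (swapAt-same i π k))
  cases (no i≢j) = begin
    stat g (swapAt i j π) + (g i (σ i) + g j (σ j))                                  ≡⟨ total (λ k → g k (σ′ k)) _ _ ⟩
    ∑ (λ k → g k (σ′ k) + (at i (g i (σ i)) k + at j (g j (σ j)) k))                 ≡⟨ sum-cong-≗ (λ k → point i≢j k (k Fin.≟ i) (k Fin.≟ j)) ⟩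
    ∑ (λ k → g k (σ k) + (at i (g i (σ j)) k + at j (g j (σ i)) k))                  ≡⟨ sym (total (λ k → g k (σ k)) _ _) ⟩
    stat g π + (g i (σ j) + g j (σ i))                                               ∎

-- A locally optimal perfect matching

module BalancedMatching {n Z : ℕ} (F H : Fin n → Fin n → ℕ) (F≤1 : ∀ l r → F l r ≤ 1) (H≤1 : ∀ l r → H l r ≤ 1)
  (G : Fin Z → Fin n → Fin n → ℕ) (G≤1 : ∀ z l r → G z l r ≤ 1) (b K K′ W : ℕ)
  (F-row : ∀ l → ∑ (F l) ≤ b) (H-col : ∀ r → ∑ (λ l → H l r) ≤ b) (2b<n : b + b < n)
  (G-sum : ∀ l r → ∑ (λ z → G z l r) ≤ K′) (G-total : ∀ z → ∑∑ (G z) ≤ n * K) where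

  -- With F and H flagging largeness at the left and right end, this is the number of large ends of
  -- an edge.
  C : Fin n → Fin n → ℕ
  C l r = F l r + H l r

  Φ : Permutation′ n → ℕ
  Φ π = W * stat C π + ∑ λ z → stat (G z) π * stat (G z) π

  Avoids : Fin n → Fin n → Set
  Avoids l r = F l r ≡ 0 ⊎ H l r ≡ 0

  avoids? : ∀ l r → Dec (Avoids l r)
  avoids? l r = (F l r ≟ℕ 0) ⊎-dec (H l r ≟ℕ 0)

  Admissible : Permutation′ n → Set
  Admissible π = ∀ i → Avoids i (π ⟨$⟩ʳ i)

  -- Any pair can be repaired: make the new edge at i small on its left and the new edge at π i
  -- small on its right. This excludes at most b + b < n choices of j.
  admissible : ∃ Admissible
  admissible = Repair.repair Avoids (λ _ _ → ⊤) fix Perm.id (λ _ → inj₂ tt)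
    where
    fix : ∀ (π : Permutation′ n) i → ⊤ → ∃ λ j → Avoids i (π ⟨$⟩ʳ j) × Avoids j (π ⟨$⟩ʳ i)
    fix π i _ =
      let j , z = ∑<n⇒zero (λ j → F i (π ⟨$⟩ʳ j) + H j (π ⟨$⟩ʳ i)) bound
      in j , inj₁ (m+n≡0⇒m≡0 _ z) , inj₂ (m+n≡0⇒n≡0 (F i (π ⟨$⟩ʳ j)) z)
      where
      bound : ∑ (λ j → F i (π ⟨$⟩ʳ j) + H j (π ⟨$⟩ʳ i)) < n
      bound = ≤-<-trans (≤-reflexive (∑-distrib-+ (λ j → F i (π ⟨$⟩ʳ j)) (λ j → H j (π ⟨$⟩ʳ i))))
        (≤-<-trans (+-mono-≤ (≤-trans (∑-inj (perm-injective π) (F i)) (F-row i)) (H-col (π ⟨$⟩ʳ i))) 2b<n)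

  Allowed : Permutation′ n → Fin n → Fin n → Set
  Allowed π i j = Avoids i (π ⟨$⟩ʳ j) × Avoids j (π ⟨$⟩ʳ i)

  allowed? : ∀ π i j → Dec (Allowed π i j)
  allowed? π i j = avoids? i (π ⟨$⟩ʳ j) ×-dec avoids? j (π ⟨$⟩ʳ i)

  LocalMin : Permutation′ n → Set
  LocalMin π = ∀ i j → Allowed π i j → Φ π ≤ Φ (swapAt i j π)

  localMin : ∃ λ π → Admissible π × LocalMin π
  localMin = descend (proj₁ admissible) (proj₂ admissible) (<-wellFounded _)
    where
    descend : ∀ π → Admissible π → Acc _<_ (Φ π) → ∃ λ π′ → Admissible π′ × LocalMin π′
    descend π ad (acc rec) = cases (Fin.any? λ i → Fin.any? λ j → allowed? π i j ×-dec (Φ (swapAt i j π) <? Φ π))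
      where
      cases : Dec (∃₂ λ i j → Allowed π i j × Φ (swapAt i j π) < Φ π) → ∃ λ π′ → Admissible π′ × LocalMin π′
      cases (yes (i , j , (ij , ji) , lt)) = descend (swapAt i j π) (λ k → swapAt-elim Avoids i j π ij ji (ad k)) (rec lt)
      cases (no none) = π , ad , λ i j al → ≮⇒≥ λ lt → none (i , j , al , lt)

  module _ (π : Permutation′ n) (ad : Admissible π) (lm : LocalMin π) where

    private
      σ = π ⟨$⟩ʳ_

    P : Fin Z → ℕ
    P z = stat (G z) π

    a : Fin Z → Fin n → Fin n → ℕ
    a z i j = G z i (σ j)

    -- The positive terms of `square-change` for the exchange of i and j, which bound the growth of
    -- the square of P z.
    gain : Fin n → Fin n → Fin Z → ℕ
    gain i j z = 2 * (P z * (a z i j + a z j i)) + 2 * (a z i j + a z j i + (a z i i + a z j j))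

    S : Fin n → ℕ
    S i = ∑ λ z → P z * a z i i

    al : Fin n → Fin n → ℕ
    al i j = ind (allowed? π i j)

    C-σ≤1 : ∀ i → C i (σ i) ≤ 1
    C-σ≤1 i with ad i
    ... | inj₁ F≡0 rewrite F≡0 = H≤1 i (σ i)
    ... | inj₂ H≡0 rewrite H≡0 | +-identityʳ (F i (σ i)) = F≤1 i (σ i)

    C≥2 : ∀ {l r} → ¬ Avoids l r → 2 ≤ C l r
    C≥2 {l} {r} ¬av = +-mono-≤ (n≢0⇒n>0 (¬av ∘ inj₁)) (n≢0⇒n>0 (¬av ∘ inj₂))

    -- Local minimality is compared with the exact change of the cost and the bound on the squares.
    -- Of the squares' decrease only the part due to tile i, namely 2 S i, is kept.
    pair-allowed : ∀ i j → Allowed π i j → W * (C i (σ i) + C j (σ j)) + 2 * S i ≤ W * (C i (σ j) + C j (σ i)) + ∑ (gain i j)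
    pair-allowed i j allowed = +-cancelˡ-≤ (W * stat C π + ∑ (λ z → P z * P z)) _ _ (begin
      W * stat C π + ∑ (λ z → P z * P z) + (W * (C i (σ i) + C j (σ j)) + 2 * S i)
        ≤⟨ +-mono-≤ (lm i j allowed) (+-monoʳ-≤ (W * (C i (σ i) + C j (σ j))) 2S≤) ⟩
      W * stat C π′ + ∑ (λ z → P′ z * P′ z) + (W * (C i (σ i) + C j (σ j)) + ∑ (λ z → 2 * (P z * (a z i i + a z j j))))
        ≡⟨ shuffle₁ W (stat C π′) _ (C i (σ i) + C j (σ j)) _ ⟩
      W * (stat C π′ + (C i (σ i) + C j (σ j))) + (∑ (λ z → P′ z * P′ z) + ∑ (λ z → 2 * (P z * (a z i i + a z j j))))
        ≡⟨ cong₂ _+_ (cong (W *_) (stat-swap C i j π)) (sym (∑-distrib-+ (λ z → P′ z * P′ z) (λ z → 2 * (P z * (a z i i + a z j j))))) ⟩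
      W * (stat C π + (C i (σ j) + C j (σ i))) + ∑ (λ z → P′ z * P′ z + 2 * (P z * (a z i i + a z j j)))
        ≤⟨ +-monoʳ-≤ (W * (stat C π + (C i (σ j) + C j (σ i)))) (∑-mono (λ z → ≤-trans
             (square-change (P z) (P′ z) (a z i j + a z j i) (a z i i + a z j j) (stat-swap (G z) i j π)
               (+-mono-≤ (G≤1 z i (σ j)) (G≤1 z j (σ i))) (+-mono-≤ (G≤1 z i (σ i)) (G≤1 z j (σ j))))
             (≤-reflexive (+-assoc (P z * P z) _ _)))) ⟩
      W * (stat C π + (C i (σ j) + C j (σ i))) + ∑ (λ z → P z * P z + gain i j z)
        ≡⟨ cong (W * (stat C π + (C i (σ j) + C j (σ i))) +_) (∑-distrib-+ (λ z → P z * P z) (gain i j)) ⟩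
      W * (stat C π + (C i (σ j) + C j (σ i))) + (∑ (λ z → P z * P z) + ∑ (gain i j))
        ≡⟨ shuffle₂ W (stat C π) _ _ _ ⟩
      W * stat C π + ∑ (λ z → P z * P z) + (W * (C i (σ j) + C j (σ i)) + ∑ (gain i j)) ∎)
      where
      open ≤-Reasoning
      π′ = swapAt i j π
      P′ : Fin Z → ℕ
      P′ z = stat (G z) π′
      shuffle₁ : ∀ W s p c q → W * s + p + (W * c + q) ≡ W * (s + c) + (p + q)
      shuffle₁ = solve-∀
      shuffle₂ : ∀ W s c p g → W * (s + c) + (p + g) ≡ W * s + p + (W * c + g)
      shuffle₂ = solve-∀
      2S≤ : 2 * S i ≤ ∑ (λ z → 2 * (P z * (a z i i + a z j j)))
      2S≤ = ≤-trans (≤-reflexive (*-distribˡ-sum 2 (λ z → P z * a z i i)))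
              (∑-mono λ z → *-monoʳ-≤ 2 (*-monoʳ-≤ (P z) (m≤m+n (a z i i) (a z j j))))

    -- A forbidden exchange creates an edge large at both ends, so its cost is at least 2, while two
    -- admissible edges together cost at most 2. Thus the inequality holds for all pairs, with the
    -- term 2 S i only for allowed ones.
    pair : ∀ i j → W * (C i (σ i) + C j (σ j)) + al i j * (2 * S i) ≤ W * (C i (σ j) + C j (σ i)) + ∑ (gain i j)
    pair i j = cases (allowed? π i j)
      where
      cases : ∀ (d : Dec (Allowed π i j)) → W * (C i (σ i) + C j (σ j)) + ind d * (2 * S i) ≤ W * (C i (σ j) + C j (σ i)) + ∑ (gain i j)
      cases (yes allowed) = ≤-trans (≤-reflexive (cong (W * (C i (σ i) + C j (σ j)) +_) (*-identityˡ (2 * S i)))) (pair-allowed i j allowed)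
      cases (no ¬allowed) = ≤-trans (≤-reflexive (+-identityʳ _)) (≤-trans (*-monoʳ-≤ W (≤-trans (+-mono-≤ (C-σ≤1 i) (C-σ≤1 j)) 2≤)) (m≤m+n _ _))
        where
        2≤ : 2 ≤ C i (σ j) + C j (σ i)
        2≤ with avoids? i (σ j) | avoids? j (σ i)
        ... | no ¬ij | _      = ≤-trans (C≥2 ¬ij) (m≤m+n _ _)
        ... | yes _  | no ¬ji = ≤-trans (C≥2 ¬ji) (m≤n+m _ (C i (σ j)))
        ... | yes ij | yes ji = contradiction (ij , ji) ¬allowed

    -- An exchange is allowed unless the new edge at i is large on its left or the one at σ i is
    -- large on its right, so at most 2b partners are forbidden.
    al-row : ∀ v → v + (b + b) ≤ n → ∀ i → v ≤ ∑ (al i)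
    al-row v v+2b≤n i = +-cancelʳ-≤ (b + b) _ _ (begin
      v + (b + b)                                                              ≤⟨ v+2b≤n ⟩
      n                                                                        ≡⟨ trans (sym (*-identityʳ n)) (sym (∑-const n 1)) ⟩
      ∑ {n} (λ _ → 1)                                                          ≤⟨ ∑-mono (λ j → covered j (allowed? π i j)) ⟩
      ∑ (λ j → al i j + (F i (σ j) + H j (σ i)))                               ≡⟨ ∑-distrib-+ (al i) (λ j → F i (σ j) + H j (σ i)) ⟩
      ∑ (al i) + ∑ (λ j → F i (σ j) + H j (σ i))                               ≡⟨ cong (∑ (al i) +_) (∑-distrib-+ (λ j → F i (σ j)) (λ j → H j (σ i))) ⟩
      ∑ (al i) + (∑ (λ j → F i (σ j)) + ∑ (λ j → H j (σ i)))                   ≤⟨ +-monoʳ-≤ (∑ (al i)) (+-mono-≤ (≤-trans (∑-inj (perm-injective π) (F i)) (F-row i)) (H-col (σ i))) ⟩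
      ∑ (al i) + (b + b)                                                       ∎)
      where
      open ≤-Reasoning
      covered : ∀ j (d : Dec (Allowed π i j)) → 1 ≤ ind d + (F i (σ j) + H j (σ i))
      covered j (yes _) = s≤s z≤n
      covered j (no ¬al) = n≢0⇒n>0 λ z → ¬al (inj₁ (m+n≡0⇒m≡0 _ z) , inj₂ (m+n≡0⇒n≡0 (F i (σ j)) z))

    ∑S : ∑ S ≡ ∑ λ z → P z * P z
    ∑S = trans (∑-comm (λ i z → P z * a z i i)) (sum-cong-≗ λ z → sym (*-distribˡ-sum (P z) (λ i → a z i i)))

    ∑P≤ : ∑ P ≤ n * K′
    ∑P≤ = ≤-trans (≤-reflexive (∑-comm (λ z i → a z i i))) (∑-bound K′ λ i → G-sum i (σ i))

    ∑∑-σ : ∀ (g : Fin n → Fin n → ℕ) → ∑∑ (λ i j → g i (σ j)) ≤ ∑∑ g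
    ∑∑-σ g = ∑-mono λ i → ∑-inj (perm-injective π) (g i)

    ∑∑-both : ∀ (g : Fin n → Fin n → ℕ) → ∑∑ (λ i j → g i (σ j) + g j (σ i)) ≤ 2 * ∑∑ g
    ∑∑-both g = begin
      ∑∑ (λ i j → g i (σ j) + g j (σ i))                        ≡⟨ ∑∑-+ (λ i j → g i (σ j)) (λ i j → g j (σ i)) ⟩
      ∑∑ (λ i j → g i (σ j)) + ∑∑ (λ i j → g j (σ i))           ≡⟨ cong (∑∑ (λ i j → g i (σ j)) +_) (∑-comm (λ i j → g j (σ i))) ⟩
      ∑∑ (λ i j → g i (σ j)) + ∑∑ (λ j i → g j (σ i))           ≤⟨ +-mono-≤ (∑∑-σ g) (∑∑-σ g) ⟩
      ∑∑ g + ∑∑ g                                               ≡⟨ cong (∑∑ g +_) (sym (+-identityʳ (∑∑ g))) ⟩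
      2 * ∑∑ g                                                  ∎
      where open ≤-Reasoning

    ∑∑C≤ : ∑∑ C ≤ n * b + n * b
    ∑∑C≤ = begin
      ∑∑ C                            ≡⟨ ∑∑-+ F H ⟩
      ∑∑ F + ∑∑ H                     ≡⟨ cong (∑∑ F +_) (∑-comm H) ⟩
      ∑∑ F + ∑∑ (λ r l → H l r)       ≤⟨ +-mono-≤ (∑-bound b F-row) (∑-bound b H-col) ⟩
      n * b + n * b                   ∎
      where open ≤-Reasoning

    -- For each z the new edges contribute at most 2nK in total, weighted by 2 P z, and the P z sum
    -- to at most nK′. The remaining terms are at most 8K′ per pair. Hence the total is quadratic in
    -- n for fixed K and K′.
    ∑∑gain≤ : ∑∑ (λ i j → ∑ (gain i j)) ≤ 4 * (n * K) * (n * K′) + n * (n * (8 * K′))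
    ∑∑gain≤ = begin
      ∑∑ (λ i j → ∑ (gain i j))                                       ≡⟨ sum-cong-≗ (λ i → sum-cong-≗ (λ j → ∑-distrib-+ (λ z → f z i j) (λ z → g z i j))) ⟩
      ∑∑ (λ i j → ∑ (λ z → f z i j) + ∑ (λ z → g z i j))              ≡⟨ ∑∑-+ (λ i j → ∑ (λ z → f z i j)) (λ i j → ∑ (λ z → g z i j)) ⟩
      ∑∑ (λ i j → ∑ (λ z → f z i j)) + ∑∑ (λ i j → ∑ (λ z → g z i j)) ≤⟨ +-mono-≤ first (∑∑-bound (8 * K′) second) ⟩
      4 * (n * K) * (n * K′) + n * (n * (8 * K′))                     ∎
      where
      open ≤-Reasoning
      f g : Fin Z → Fin n → Fin n → ℕ
      f z i j = 2 * (P z * (a z i j + a z j i))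
      g z i j = 2 * (a z i j + a z j i + (a z i i + a z j j))
      f-z : ∀ z → ∑∑ (f z) ≤ 4 * (n * K) * P z
      f-z z = begin
        ∑∑ (f z)                                         ≡⟨ ∑∑-* 2 (λ i j → P z * (a z i j + a z j i)) ⟩
        2 * ∑∑ (λ i j → P z * (a z i j + a z j i))       ≡⟨ cong (2 *_) (∑∑-* (P z) (λ i j → a z i j + a z j i)) ⟩
        2 * (P z * ∑∑ (λ i j → a z i j + a z j i))       ≤⟨ *-monoʳ-≤ 2 (*-monoʳ-≤ (P z) (≤-trans (∑∑-both (G z)) (*-monoʳ-≤ 2 (G-total z)))) ⟩
        2 * (P z * (2 * (n * K)))                        ≡⟨ arith (P z) (n * K) ⟩
        4 * (n * K) * P z                                ∎
        where arith : ∀ p m → 2 * (p * (2 * m)) ≡ 4 * m * p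
              arith = solve-∀
      first : ∑∑ (λ i j → ∑ (λ z → f z i j)) ≤ 4 * (n * K) * (n * K′)
      first = begin
        ∑∑ (λ i j → ∑ (λ z → f z i j))       ≡⟨ ∑∑∑-comm f ⟩
        ∑ (λ z → ∑∑ (f z))                   ≤⟨ ∑-mono f-z ⟩
        ∑ (λ z → 4 * (n * K) * P z)          ≡⟨ sym (*-distribˡ-sum (4 * (n * K)) P) ⟩
        4 * (n * K) * ∑ P                    ≤⟨ *-monoʳ-≤ (4 * (n * K)) ∑P≤ ⟩
        4 * (n * K) * (n * K′)               ∎
      second : ∀ i j → ∑ (λ z → g z i j) ≤ 8 * K′
      second i j = begin
        ∑ (λ z → g z i j)                                                              ≡⟨ sym (*-distribˡ-sum 2 (λ z → a z i j + a z j i + (a z i i + a z j j))) ⟩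
        2 * ∑ (λ z → a z i j + a z j i + (a z i i + a z j j))                          ≡⟨ cong (2 *_) (trans (∑-distrib-+ (λ z → a z i j + a z j i) (λ z → a z i i + a z j j)) (cong₂ _+_ (∑-distrib-+ (λ z → a z i j) (λ z → a z j i)) (∑-distrib-+ (λ z → a z i i) (λ z → a z j j)))) ⟩
        2 * (∑ (λ z → a z i j) + ∑ (λ z → a z j i) + (∑ (λ z → a z i i) + ∑ (λ z → a z j j))) ≤⟨ *-monoʳ-≤ 2 (+-mono-≤ (+-mono-≤ (G-sum i (σ j)) (G-sum j (σ i))) (+-mono-≤ (G-sum i (σ i)) (G-sum j (σ j)))) ⟩
        2 * (K′ + K′ + (K′ + K′))                                                      ≡⟨ arith K′ ⟩
        8 * K′                                                                         ∎
        where arith : ∀ k → 2 * (k + k + (k + k)) ≡ 8 * k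
              arith = solve-∀

    cost-sum : ∑∑ (λ i j → W * (C i (σ i) + C j (σ j))) ≡ W * (n * stat C π + n * stat C π)
    cost-sum = trans (∑∑-* W (λ i j → C i (σ i) + C j (σ j))) (cong (W *_) (trans (∑∑-+ {n} {n} (λ i j → C i (σ i)) (λ i j → C j (σ j)))
      (cong₂ _+_ (trans (∑-comm {n} {n} (λ i j → C i (σ i))) (∑-const n (stat C π))) (∑-const n (stat C π)))))

    -- Summing `pair` over all ordered pairs counts every tile 2n times in the cost and every S i at
    -- least v times, and `∑S` turns the latter into squares. One inequality thus controls both the
    -- number of large ends and all P z.
    swap-average : ∀ v → v + (b + b) ≤ n →
      W * (n * stat C π + n * stat C π) + v * (2 * ∑ (λ z → P z * P z)) ≤
      W * (2 * (n * b + n * b)) + (4 * (n * K) * (n * K′) + n * (n * (8 * K′)))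
    swap-average v v+2b≤n = begin
      W * (n * stat C π + n * stat C π) + v * (2 * ∑ (λ z → P z * P z))
        ≡⟨ cong₂ _+_ (sym cost-sum) (cong (λ x → v * (2 * x)) (sym ∑S)) ⟩
      ∑∑ (λ i j → W * (C i (σ i) + C j (σ j))) + v * (2 * ∑ S)
        ≡⟨ cong (∑∑ (λ i j → W * (C i (σ i) + C j (σ j))) +_) (trans (cong (v *_) (*-distribˡ-sum 2 S)) (*-distribˡ-sum v (λ i → 2 * S i))) ⟩
      ∑∑ (λ i j → W * (C i (σ i) + C j (σ j))) + ∑ (λ i → v * (2 * S i))
        ≤⟨ +-monoʳ-≤ (∑∑ (λ i j → W * (C i (σ i) + C j (σ j)))) (∑-mono λ i → ≤-trans (*-monoˡ-≤ (2 * S i) (al-row v v+2b≤n i)) (≤-reflexive (*-distribʳ-sum (2 * S i) (al i)))) ⟩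
      ∑∑ (λ i j → W * (C i (σ i) + C j (σ j))) + ∑∑ (λ i j → al i j * (2 * S i))
        ≡⟨ sym (∑∑-+ (λ i j → W * (C i (σ i) + C j (σ j))) (λ i j → al i j * (2 * S i))) ⟩
      ∑∑ (λ i j → W * (C i (σ i) + C j (σ j)) + al i j * (2 * S i))
        ≤⟨ ∑∑-mono pair ⟩
      ∑∑ (λ i j → W * (C i (σ j) + C j (σ i)) + ∑ (gain i j))
        ≡⟨ ∑∑-+ (λ i j → W * (C i (σ j) + C j (σ i))) (λ i j → ∑ (gain i j)) ⟩
      ∑∑ (λ i j → W * (C i (σ j) + C j (σ i))) + ∑∑ (λ i j → ∑ (gain i j))
        ≤⟨ +-mono-≤ (≤-trans (≤-reflexive (∑∑-* W (λ i j → C i (σ j) + C j (σ i)))) (*-monoʳ-≤ W (≤-trans (∑∑-both C) (*-monoʳ-≤ 2 ∑∑C≤)))) ∑∑gain≤ ⟩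
      W * (2 * (n * b + n * b)) + (4 * (n * K) * (n * K′) + n * (n * (8 * K′))) ∎
      where open ≤-Reasoning

  balanced : ∀ v → v + (b + b) ≤ n → ∃ λ π → Admissible π ×
    W * (n * stat C π + n * stat C π) + v * (2 * ∑ (λ z → stat (G z) π * stat (G z) π)) ≤
    W * (2 * (n * b + n * b)) + (4 * (n * K) * (n * K′) + n * (n * (8 * K′)))
  balanced v v+2b≤n = let π , ad , lm = localMin in π , ad , swap-average π ad lm v v+2b≤n

-- From closed walks to properly coloured cycles

toℕ-next : ∀ {k} (i : Fin k) → toℕ (next i) ≡ suc (toℕ i) ⊎ (suc (toℕ i) ≡ k × toℕ (next i) ≡ 0)
toℕ-next {suc k} i with m≤n⇒m<n∨m≡n (Fin.toℕ<n i)
... | inj₁ lt = inj₁ (trans (Fin.toℕ-fromℕ< (m%n<n (suc (toℕ i)) (suc k))) (m<n⇒m%n≡m lt))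
... | inj₂ eq = inj₂ (eq , trans (Fin.toℕ-fromℕ< (m%n<n (suc (toℕ i)) (suc k))) (trans (cong (_% suc k) eq) (n%n≡0 (suc k))))

-- Properness at i looks two vertices ahead, so wrapping around takes the two identifications `V-k`
-- and `V-suck`.
module _ {n : ℕ} (c : Coloring n) {k : ℕ} (V : ℕ → Vertex n) (V-k : V k ≡ V 0) (V-suck : V (suc k) ≡ V 1) where

  V-next : ∀ (i : Fin k) → V (toℕ (next i)) ≡ V (suc (toℕ i))
  V-next i with toℕ-next i
  ... | inj₁ eq         = cong V eq
  ... | inj₂ (eq , eq₀) = trans (cong V eq₀) (trans (sym V-k) (cong V (sym eq)))

  V-next² : ∀ (i : Fin k) → V (toℕ (next (next i))) ≡ V (suc (suc (toℕ i)))
  V-next² i with toℕ-next i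
  ... | inj₁ eq         = trans (V-next (next i)) (cong (V ∘ suc) eq)
  ... | inj₂ (eq , eq₀) = trans (V-next (next i)) (trans (cong (V ∘ suc) eq₀) (trans (sym V-suck) (cong (V ∘ suc) (sym eq))))

  closeUp : (∀ x y → x < k → y < k → V x ≡ V y → x ≡ y) → (∀ x → Adj (V x) (V (suc x))) →
            (∀ x → x < k → edgeColor c (V x) (V (suc x)) ≢ edgeColor c (V (suc x)) (V (suc (suc x)))) →
            ∀ x → x < k → HasPCCycleThrough c k (V x)
  closeUp inj adj proper x x<k =
    V ∘ toℕ ,
    ((λ {i} {j} e → Fin.toℕ-injective (inj _ _ (Fin.toℕ<n i) (Fin.toℕ<n j) e)) ,
     λ i → subst (Adj (V (toℕ i))) (sym (V-next i)) (adj (toℕ i))) ,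
    (λ i → subst₂ (λ y z → edgeColor c (V (toℕ i)) y ≢ edgeColor c y z) (sym (V-next i)) (sym (V-next² i)) (proper (toℕ i) (Fin.toℕ<n i))) ,
    fromℕ< x<k , cong V (Fin.toℕ-fromℕ< x<k)

even-or-odd : ∀ x → ∃ λ t → x ≡ 2 * t ⊎ x ≡ suc (2 * t)
even-or-odd zero    = 0 , inj₁ refl
even-or-odd (suc x) with even-or-odd x
... | t , inj₁ refl = t , inj₂ refl
... | t , inj₂ refl = suc t , inj₁ (sym (*-suc 2 t))

module _ {n : ℕ} (c : Coloring n) {L R : Fin n → Fin n} (L-inj : Injective _≡_ _≡_ L) (R-inj : Injective _≡_ _≡_ R)
  {i₀ : Fin n} {k : ℕ} (walk : ClosedWalk (λ i j → c (L i) (R j)) i₀ k) where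

  open ClosedWalk walk

  -- Traverses each tile from left to right and then the arc edge to the left end of the next tile.
  zigzag : (ℕ → Fin n) → ℕ → Vertex n
  zigzag τ zero          = inj₁ (L (τ 0))
  zigzag τ (suc zero)    = inj₂ (R (τ 0))
  zigzag τ (suc (suc x)) = zigzag (τ ∘ suc) x

  zigzag-even : ∀ τ t → zigzag τ (2 * t) ≡ inj₁ (L (τ t))
  zigzag-even τ zero    = refl
  zigzag-even τ (suc t) = trans (cong (zigzag τ) (*-suc 2 t)) (zigzag-even (τ ∘ suc) t)

  zigzag-odd : ∀ τ t → zigzag τ (suc (2 * t)) ≡ inj₂ (R (τ t))
  zigzag-odd τ zero    = refl
  zigzag-odd τ (suc t) = trans (cong (zigzag τ ∘ suc) (*-suc 2 t)) (zigzag-odd (τ ∘ suc) t)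

  zigzag-adj : ∀ τ x → Adj (zigzag τ x) (zigzag τ (suc x))
  zigzag-adj τ zero          = tt
  zigzag-adj τ (suc zero)    = tt
  zigzag-adj τ (suc (suc x)) = zigzag-adj (τ ∘ suc) x

  private
    V = zigzag τ
    m = suc k

  half< : ∀ {t} → 2 * t < 2 * m → t ≤ k
  half< {t} lt = s≤s⁻¹ (*-cancelˡ-< 2 t m lt)

  V-inj : ∀ x y → x < 2 * m → y < 2 * m → V x ≡ V y → x ≡ y
  V-inj x y x< y< e with even-or-odd x | even-or-odd y
  ... | s , inj₁ refl | t , inj₁ refl = cong (2 *_) (τ-inj s t (half< x<) (half< y<)
        (L-inj (inj₁-injective (trans (sym (zigzag-even τ s)) (trans e (zigzag-even τ t))))))
  ... | s , inj₂ refl | t , inj₂ refl = cong (λ t → suc (2 * t)) (τ-inj s t (half< (<⇒≤ x<)) (half< (<⇒≤ y<))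
        (R-inj (inj₂-injective (trans (sym (zigzag-odd τ s)) (trans e (zigzag-odd τ t))))))
  ... | s , inj₁ refl | t , inj₂ refl with trans (sym (zigzag-even τ s)) (trans e (zigzag-odd τ t))
  ...   | ()
  V-inj x y x< y< e | s , inj₂ refl | t , inj₁ refl with trans (sym (zigzag-odd τ s)) (trans e (zigzag-even τ t))
  ...   | ()

  -- A tile followed by an arc edge uses the first inequality of `Arc`; an arc edge followed by a
  -- tile uses the second.
  V-proper : ∀ x → x < 2 * m → edgeColor c (V x) (V (suc x)) ≢ edgeColor c (V (suc x)) (V (suc (suc x)))
  V-proper x x< with even-or-odd x
  ... | t , inj₁ refl rewrite zigzag-even τ t | zigzag-odd τ t | zigzag-even (τ ∘ suc) t = λ e → proj₁ (τ-arc t (half< x<)) (sym e)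
  ... | t , inj₂ refl rewrite zigzag-odd τ t | zigzag-even (τ ∘ suc) t | zigzag-odd (τ ∘ suc) t = proj₂ (τ-arc t (half< (<⇒≤ x<)))

  walk⇒cycle : ∀ x → x < 2 * m → HasPCCycleThrough c (2 * m) (V x)
  walk⇒cycle = closeUp c V
    (trans (zigzag-even τ m) (cong (inj₁ ∘ L) (trans τ-closed (sym τ-zero))))
    (trans (zigzag-odd τ m) (cong (inj₂ ∘ R) (trans τ-closed (sym τ-zero))))
    V-inj (zigzag-adj τ) V-proper

  cycle-left : HasPCCycleThrough c (2 * m) (inj₁ (L i₀))
  cycle-left = subst (HasPCCycleThrough c (2 * m) ∘ inj₁ ∘ L) τ-zero (walk⇒cycle 0 (s≤s z≤n))

  cycle-right : HasPCCycleThrough c (2 * m) (inj₂ (R i₀))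
  cycle-right = subst (HasPCCycleThrough c (2 * m) ∘ inj₂ ∘ R) τ-zero (walk⇒cycle 1 (≤-trans (s≤s (s≤s z≤n)) (*-monoʳ-≤ 2 (s≤s (z≤n {k})))))

-- Colour classes that are not large

small⇒class≤ : ∀ K {n} (f : Fin n → ℕ) a → large K f a ≡ 0 → class f a ≤ K
small⇒class≤ K f a l≡0 = ≮⇒≥ (ind≡0⇒¬ (K <? class f a) l≡0)

small-class≤ : ∀ K {n} (f : Fin n → ℕ) a → (1 ∸ large K f a) * class f a ≤ K
small-class≤ K f a with K <? class f a
... | yes _  = z≤n
... | no K≮ = ≤-trans (≤-reflexive (+-identityʳ (class f a))) (≮⇒≥ K≮)

-- Largeness depends on the colour only: either a is large and every term vanishes, or its whole
-- class has at most K members.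
small-members≤ : ∀ K {n} (f : Fin n → ℕ) a → ∑ (λ k → (1 ∸ large K f (f k)) * δ a (f k)) ≤ K
small-members≤ K f a = begin
  ∑ (λ k → (1 ∸ large K f (f k)) * δ a (f k))     ≡⟨ sum-cong-≗ transfer ⟩
  ∑ (λ k → (1 ∸ large K f a) * δ (f k) a)         ≡⟨ sym (*-distribˡ-sum (1 ∸ large K f a) (λ k → δ (f k) a)) ⟩
  (1 ∸ large K f a) * class f a                   ≤⟨ small-class≤ K f a ⟩
  K                                               ∎
  where
  open ≤-Reasoning
  transfer : ∀ k → (1 ∸ large K f (f k)) * δ a (f k) ≡ (1 ∸ large K f a) * δ (f k) a
  transfer k = trans (cong ((1 ∸ large K f (f k)) *_) (δ-sym a (f k))) (cases (f k ≟ℕ a))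
    where
    cases : ∀ (d : Dec (f k ≡ a)) → (1 ∸ large K f (f k)) * ind d ≡ (1 ∸ large K f a) * ind d
    cases (yes e) = cong (λ x → (1 ∸ large K f x) * 1) e
    cases (no _)  = trans (*-zeroʳ (1 ∸ large K f (f k))) (sym (*-zeroʳ (1 ∸ large K f a)))

1∸*δ≤1 : ∀ x a b → (1 ∸ x) * δ a b ≤ 1
1∸*δ≤1 x a b = *-mono-≤ (m∸n≤m 1 x) (ind≤1 (a ≟ℕ b))

≤-/ : ∀ {m n o} .{{_ : NonZero o}} → m * o ≤ n → m ≤ n / o
≤-/ {m} {n} {o} le = ≤-trans (≤-reflexive (sym (m*n/n≡m m o))) (/-monoˡ-≤ o le)

-- Arithmetic of the constants

module Constants (q-1 n : ℕ) where

  -- For degrees at least (2/3 + 1/q)n: s bounds n - d, A a colour class, b the large edges at a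
  -- vertex with K = q, and h the popularities. E collects the quadratic gain terms, and W = qE
  -- reduces their effect on the cost to n/q.
  q E W s b h A : ℕ
  q = suc q-1
  E = 4 * (q * q) + 8 * q
  W = q * E
  s = (q * n ∸ 3 * n) / (3 * q)
  b = (suc q * s) / q
  h = n / (8 * q)
  A = s + 1

  -- The first summand makes the root of the bound on the squares at most n/(8q); the second is
  -- 6q(3q + 3), absorbing the additive constants in `size`.
  threshold : ℕ
  threshold = 64 * (q * q) * ((2 * q + 3) * E) + (18 * (q * q) + 18 * q)

  module _ (3≤q : 3 ≤ q) where

    s-bound : 3 * q * s + 3 * n ≤ q * n
    s-bound = begin
      3 * q * s + 3 * n              ≡⟨ cong (_+ 3 * n) (*-comm (3 * q) s) ⟩
      s * (3 * q) + 3 * n            ≤⟨ +-monoˡ-≤ (3 * n) (m/n*n≤m (q * n ∸ 3 * n) (3 * q)) ⟩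
      q * n ∸ 3 * n + 3 * n          ≡⟨ m∸n+n≡m (*-monoˡ-≤ n 3≤q) ⟩
      q * n                          ∎
      where open ≤-Reasoning

    3s≤n : 3 * s ≤ n
    3s≤n = *-cancelˡ-≤ q (begin
      q * (3 * s)                    ≡⟨ arith q s ⟩
      3 * q * s                      ≤⟨ m≤m+n _ (3 * n) ⟩
      3 * q * s + 3 * n              ≤⟨ s-bound ⟩
      q * n                          ∎)
      where
      open ≤-Reasoning
      arith : ∀ q s → q * (3 * s) ≡ 3 * q * s
      arith = solve-∀

    b-bound : q * b ≤ suc q * s
    b-bound = ≤-trans (≤-reflexive (*-comm q b)) (m/n*n≤m (suc q * s) q)

    -- The reason is that (1 + 1/q)(1/3 - 1/q) < 1/3.
    3b≤n : 3 * b ≤ n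
    3b≤n = *-cancelˡ-≤ (q * q) (+-cancelʳ-≤ (3 * (suc q * n)) _ _ (begin
      q * q * (3 * b) + 3 * (suc q * n)              ≡⟨ cong (_+ 3 * (suc q * n)) (arith₁ q b) ⟩
      3 * q * (q * b) + 3 * (suc q * n)              ≤⟨ +-monoˡ-≤ (3 * (suc q * n)) (*-monoʳ-≤ (3 * q) b-bound) ⟩
      3 * q * (suc q * s) + 3 * (suc q * n)          ≡⟨ arith₂ q s n ⟩
      suc q * (3 * q * s + 3 * n)                    ≤⟨ *-monoʳ-≤ (suc q) s-bound ⟩
      suc q * (q * n)                                ≤⟨ m≤m+n _ (2 * (q * n) + 3 * n) ⟩
      suc q * (q * n) + (2 * (q * n) + 3 * n)        ≡⟨ arith₃ q n ⟩
      q * q * n + 3 * (suc q * n)                    ∎))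
      where
      open ≤-Reasoning
      arith₁ : ∀ q b → q * q * (3 * b) ≡ 3 * q * (q * b)
      arith₁ = solve-∀
      arith₂ : ∀ q s n → 3 * q * (suc q * s) + 3 * (suc q * n) ≡ suc q * (3 * q * s + 3 * n)
      arith₂ = solve-∀
      arith₃ : ∀ q n → suc q * (q * n) + (2 * (q * n) + 3 * n) ≡ q * q * n + 3 * (suc q * n)
      arith₃ = solve-∀

    2b≤n : b + b ≤ n
    2b≤n = ≤-trans (≤-trans (m≤n+m (b + b) b) (≤-reflexive (arith b))) 3b≤n
      where arith : ∀ b → b + (b + b) ≡ 3 * b
            arith = solve-∀

    2b<n : 0 < n → b + b < n
    2b<n 0<n with m≤n⇒m<n∨m≡n 2b≤n
    ... | inj₁ lt = lt
    ... | inj₂ eq = contradiction (subst (0 <_) (trans (sym eq) (cong₂ _+_ b≡0 b≡0)) 0<n) λ ()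
      where
      arith : ∀ b → b + b + b ≡ 3 * b
      arith = solve-∀
      b≡0 : b ≡ 0
      b≡0 = n≤0⇒n≡0 (+-cancelˡ-≤ (b + b) b 0 (≤-trans (≤-reflexive (arith b)) (≤-trans 3b≤n (≤-reflexive (trans (sym eq) (sym (+-identityʳ (b + b))))))))

    v : ℕ
    v = n ∸ (b + b)

    v+2b≤n : v + (b + b) ≤ n
    v+2b≤n = ≤-reflexive (m∸n+n≡m 2b≤n)

    n≤3v : n ≤ 3 * v
    n≤3v = +-cancelʳ-≤ (2 * n) _ _ (begin
      n + 2 * n                      ≡⟨ arith₁ n ⟩
      3 * n                          ≡⟨ cong (3 *_) (sym (m∸n+n≡m 2b≤n)) ⟩
      3 * (v + (b + b))              ≡⟨ arith₂ v b ⟩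
      3 * v + 2 * (3 * b)            ≤⟨ +-monoʳ-≤ (3 * v) (*-monoʳ-≤ 2 3b≤n) ⟩
      3 * v + 2 * n                  ∎)
      where
      open ≤-Reasoning
      arith₁ : ∀ n → n + 2 * n ≡ 3 * n
      arith₁ = solve-∀
      arith₂ : ∀ v b → 3 * (v + (b + b)) ≡ 3 * v + 2 * (3 * b)
      arith₂ = solve-∀

    module _ .{{_ : NonZero n}} (large-n : threshold ≤ n) (x Q : ℕ)
      (average : W * (n * x + n * x) + v * (2 * Q) ≤ W * (2 * (n * b + n * b)) + (4 * (n * q) * (n * (q + q)) + n * (n * (8 * (q + q))))) where

      average′ : n * (W * x) + v * Q ≤ n * (2 * (W * b) + n * E)
      average′ = *-cancelˡ-≤ 2 (begin
        2 * (n * (W * x) + v * Q)                            ≡⟨ arith₁ n W x v Q ⟩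
        W * (n * x + n * x) + v * (2 * Q)                    ≤⟨ average ⟩
        W * (2 * (n * b + n * b)) + (4 * (n * q) * (n * (q + q)) + n * (n * (8 * (q + q))))  ≡⟨ arith₂ n W b q ⟩
        2 * (n * (2 * (W * b) + n * E))                      ∎)
        where
        open ≤-Reasoning
        arith₁ : ∀ n W x v Q → 2 * (n * (W * x) + v * Q) ≡ W * (n * x + n * x) + v * (2 * Q)
        arith₁ = solve-∀
        arith₂ : ∀ n W b q → W * (2 * (n * b + n * b)) + (4 * (n * q) * (n * (q + q)) + n * (n * (8 * (q + q)))) ≡ 2 * (n * (2 * (W * b) + n * (4 * (q * q) + 8 * q)))
        arith₂ = solve-∀

      cost-bound : q * x ≤ 2 * (q * b) + n
      cost-bound = *-cancelˡ-≤ E (*-cancelˡ-≤ n (begin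
        n * (E * (q * x))                      ≡⟨ arith₁ n E q x ⟩
        n * (W * x)                            ≤⟨ m≤m+n _ (v * Q) ⟩
        n * (W * x) + v * Q                    ≤⟨ average′ ⟩
        n * (2 * (W * b) + n * E)              ≡⟨ arith₂ n E q b ⟩
        n * (E * (2 * (q * b) + n))            ∎))
        where
        open ≤-Reasoning
        arith₁ : ∀ n E q x → n * (E * (q * x)) ≡ n * (q * E * x)
        arith₁ = solve-∀
        arith₂ : ∀ n E q b → n * (2 * (q * E * b) + n * E) ≡ n * (E * (2 * (q * b) + n))
        arith₂ = solve-∀

      -- Dropping the cost from the average and using v ≥ n/3 leaves a bound linear in n.
      Q-bound : Q ≤ n * ((2 * q + 3) * E)
      Q-bound = *-cancelˡ-≤ n (begin
        n * Q                                        ≤⟨ *-monoˡ-≤ Q n≤3v ⟩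
        3 * v * Q                                    ≡⟨ *-assoc 3 v Q ⟩
        3 * (v * Q)                                  ≤⟨ *-monoʳ-≤ 3 (≤-trans (m≤n+m (v * Q) (n * (W * x))) average′) ⟩
        3 * (n * (2 * (W * b) + n * E))              ≡⟨ arith₁ n W b E ⟩
        n * (2 * W * (3 * b) + 3 * (n * E))          ≤⟨ *-monoʳ-≤ n (+-monoˡ-≤ (3 * (n * E)) (*-monoʳ-≤ (2 * W) 3b≤n)) ⟩
        n * (2 * W * n + 3 * (n * E))                ≡⟨ arith₂ n q E ⟩
        n * (n * ((2 * q + 3) * E))                  ∎)
        where
        open ≤-Reasoning
        arith₁ : ∀ n W b E → 3 * (n * (2 * (W * b) + n * E)) ≡ n * (2 * W * (3 * b) + 3 * (n * E))
        arith₁ = solve-∀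
        arith₂ : ∀ n q E → n * (2 * (q * E) * n + 3 * (n * E)) ≡ n * (n * ((2 * q + 3) * E))
        arith₂ = solve-∀

      -- A single square is at most the linear bound on Q, so p is of order √n, below n/(8q) past
      -- the threshold.
      root-bound : ∀ p → p * p ≤ Q → p ≤ h
      root-bound p p²≤Q = ≤-/ {p} {n} (≮⇒≥ λ lt → <⇒≱ (*-mono-< lt lt) (begin
        p * (8 * q) * (p * (8 * q))                  ≡⟨ arith₁ p q ⟩
        64 * (q * q) * (p * p)                       ≤⟨ *-monoʳ-≤ (64 * (q * q)) (≤-trans p²≤Q Q-bound) ⟩
        64 * (q * q) * (n * ((2 * q + 3) * E))       ≡⟨ arith₂ (64 * (q * q)) n ((2 * q + 3) * E) ⟩
        64 * (q * q) * ((2 * q + 3) * E) * n         ≤⟨ *-monoˡ-≤ n (≤-trans (m≤m+n _ (18 * (q * q) + 18 * q)) large-n) ⟩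
        n * n                                        ∎))
        where
        open ≤-Reasoning
        arith₁ : ∀ p q → p * (8 * q) * (p * (8 * q)) ≡ 64 * (q * q) * (p * p)
        arith₁ = solve-∀
        arith₂ : ∀ a n c → a * (n * c) ≡ a * c * n
        arith₂ = solve-∀

      -- In units of n/q, the main terms 2b + s fall short of n by at least 3 - 2/3. The cost error
      -- 1, the popularities 1/2 and the constants 1/6 fit into this gap.
      size : x + A + 4 * h + 3 * q + 2 ≤ n
      size = *-cancelˡ-≤ (6 * q) (begin
        6 * q * (x + A + 4 * h + 3 * q + 2)                                                  ≡⟨ arith₁ q x s h ⟩
        6 * (q * x) + 6 * q * s + 3 * (h * (8 * q)) + (18 * (q * q) + 18 * q)                ≤⟨ +-mono-≤ (+-mono-≤ (+-monoˡ-≤ (6 * q * s) (*-monoʳ-≤ 6 (≤-trans cost-bound (+-monoˡ-≤ n (*-monoʳ-≤ 2 b-bound))))) (*-monoʳ-≤ 3 (m/n*n≤m n (8 * q)))) (≤-trans (m≤n+m _ (64 * (q * q) * ((2 * q + 3) * E))) large-n) ⟩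
        6 * (2 * (suc q * s) + n) + 6 * q * s + 3 * n + n                                    ≡⟨ arith₂ q s n ⟩
        6 * (3 * q * s) + 4 * (3 * s) + 10 * n                                               ≤⟨ +-monoˡ-≤ (10 * n) (+-monoʳ-≤ (6 * (3 * q * s)) (*-monoʳ-≤ 4 3s≤n)) ⟩
        6 * (3 * q * s) + 4 * n + 10 * n                                                     ≤⟨ m≤m+n _ (4 * n) ⟩
        6 * (3 * q * s) + 4 * n + 10 * n + 4 * n                                             ≡⟨ arith₃ (3 * q * s) n ⟩
        6 * (3 * q * s + 3 * n)                                                              ≤⟨ *-monoʳ-≤ 6 s-bound ⟩
        6 * (q * n)                                                                          ≡⟨ sym (*-assoc 6 q n) ⟩
        6 * q * n                                                                            ∎)
        where
        open ≤-Reasoning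
        arith₁ : ∀ q x s h → 6 * q * (x + (s + 1) + 4 * h + 3 * q + 2) ≡ 6 * (q * x) + 6 * q * s + 3 * (h * (8 * q)) + (18 * (q * q) + 18 * q)
        arith₁ = solve-∀
        arith₂ : ∀ q s n → 6 * (2 * (suc q * s) + n) + 6 * q * s + 3 * n + n ≡ 6 * (3 * q * s) + 4 * (3 * s) + 10 * n
        arith₂ = solve-∀
        arith₃ : ∀ t n → 6 * t + 4 * n + 10 * n + 4 * n ≡ 6 * (t + 3 * n)
        arith₃ = solve-∀

-- From the degree condition to the cycles

module EvenPancyclicity (q-1 N : ℕ) (c : Coloring (suc N))
  (large-n : Constants.threshold q-1 (suc N) ≤ suc N)
  (degree : ∀ v → (2 * suc q-1 + 3) * suc N ≤ 3 * suc q-1 * colorDegree c v) where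

  private
    n = suc N

  open Constants q-1 n

  degree≤ : ∀ v → colorDegree c v ≤ n
  degree≤ v = let ρ , rainbow = colorDegree-transversal c v in Fin.injective⇒≤ (ρ-inj {f = colours c v} ρ rainbow)

  -- A colour degree is at most n, so 2/3 + 1/q ≤ 1.
  3≤q : 3 ≤ q
  3≤q = +-cancelˡ-≤ (2 * q) _ _ (*-cancelʳ-≤ (2 * q + 3) (2 * q + q) n (begin
    (2 * q + 3) * n                       ≤⟨ degree (inj₁ zero) ⟩
    3 * q * colorDegree c (inj₁ zero)     ≤⟨ *-monoʳ-≤ (3 * q) (degree≤ (inj₁ zero)) ⟩
    3 * q * n                             ≡⟨ cong (_* n) (arith q) ⟩
    (2 * q + q) * n                       ∎))
    where
    open ≤-Reasoning
    arith : ∀ q → 3 * q ≡ 2 * q + q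
    arith = solve-∀

  n≤d+s : ∀ v → n ≤ colorDegree c v + s
  n≤d+s v = ≤-trans (≤-reflexive (sym (m+[n∸m]≡n (degree≤ v)))) (+-monoʳ-≤ d (≤-/ {t} (m+n≤o⇒m≤o∸n (t * (3 * q)) (+-cancelˡ-≤ (2 * (q * n)) _ _ (begin
    2 * (q * n) + (t * (3 * q) + 3 * n)     ≡⟨ arith₁ q n t ⟩
    (2 * q + 3) * n + 3 * q * t             ≤⟨ +-monoˡ-≤ (3 * q * t) (degree v) ⟩
    3 * q * d + 3 * q * t                   ≡⟨ sym (*-distribˡ-+ (3 * q) d t) ⟩
    3 * q * (d + t)                         ≡⟨ cong (3 * q *_) (m+[n∸m]≡n (degree≤ v)) ⟩
    3 * q * n                               ≡⟨ arith₂ q n ⟩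
    2 * (q * n) + q * n                     ∎)))))
    where
    open ≤-Reasoning
    d = colorDegree c v
    t = n ∸ d
    arith₁ : ∀ q n t → 2 * (q * n) + (t * (3 * q) + 3 * n) ≡ (2 * q + 3) * n + 3 * q * t
    arith₁ = solve-∀
    arith₂ : ∀ q n → 3 * q * n ≡ 2 * (q * n) + q * n
    arith₂ = solve-∀

  class≤A : ∀ v a → class (colours c v) a ≤ A
  class≤A v a =
    let ρ , rainbow = colorDegree-transversal c v
    in +-cancelˡ-≤ (colorDegree c v) _ _ (≤-trans (class-bound {f = colours c v} ρ rainbow a) (≤-trans (+-monoˡ-≤ 1 (n≤d+s v)) (≤-reflexive (+-assoc _ s 1))))

  large≤b : ∀ v → ∑ (λ k → large q (colours c v) (colours c v k)) ≤ b
  large≤b v =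
    let ρ , rainbow = colorDegree-transversal c v
        d = colorDegree c v
        B = ∑ (λ k → large q (colours c v) (colours c v k))
    in ≤-/ {B} (≤-trans (≤-reflexive (*-comm B q)) (+-cancelˡ-≤ (suc q * d) _ _
         (≤-trans (large-bound {f = colours c v} ρ rainbow q) (≤-trans (*-monoʳ-≤ (suc q) (n≤d+s v)) (≤-reflexive (*-distribˡ-+ (suc q) d s))))))

  F H : Fin n → Fin n → ℕ
  F l r = large q (c l) (c l r)
  H l r = large q (λ l′ → c l′ r) (c l r)

  -- Flags an edge l r that is small at l and has there the colour by which l sees r₀; summed over a
  -- matching it gives P at the vertex r₀. `popL` is the mirror image.
  popR popL : Fin n → Fin n → Fin n → ℕ
  popR r₀ l r = (1 ∸ F l r) * δ (c l r₀) (c l r)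
  popL l₀ l r = (1 ∸ H l r) * δ (c l₀ r) (c l r)

  G : Fin (n + n) → Fin n → Fin n → ℕ
  G z = [ popR , popL ]′ (splitAt n z)

  G-left : ∀ r₀ → G (r₀ ↑ˡ n) ≡ popR r₀
  G-left r₀ = cong [ popR , popL ]′ (Fin.splitAt-↑ˡ n r₀ n)

  G-right : ∀ l₀ → G (n ↑ʳ l₀) ≡ popL l₀
  G-right l₀ = cong [ popR , popL ]′ (Fin.splitAt-↑ʳ n n l₀)

  G-elim : ∀ (Q : (Fin n → Fin n → ℕ) → Set) → (∀ r → Q (popR r)) → (∀ l → Q (popL l)) → ∀ z → Q (G z)
  G-elim Q qR qL z with splitAt n z
  ... | inj₁ r = qR r
  ... | inj₂ l = qL l

  G≤1 : ∀ z l r → G z l r ≤ 1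
  G≤1 = G-elim (λ g → ∀ l r → g l r ≤ 1) (λ r₀ l r → 1∸*δ≤1 (F l r) (c l r₀) (c l r)) (λ l₀ l r → 1∸*δ≤1 (H l r) (c l₀ r) (c l r))

  -- The vertices for which an edge counts are the far ends of equally coloured edges at either of
  -- its ends, and only a small class contributes: at most q per end.
  G-sum : ∀ l r → ∑ (λ z → G z l r) ≤ q + q
  G-sum l r = begin
    ∑ (λ z → G z l r)                                                    ≡⟨ ∑-split n {n} (λ z → G z l r) ⟩
    ∑ {n} (λ r₀ → G (r₀ ↑ˡ n) l r) + ∑ {n} (λ l₀ → G (n ↑ʳ l₀) l r)              ≡⟨ cong₂ _+_ (sum-cong-≗ (λ r₀ → cong (λ g → g l r) (G-left r₀))) (sum-cong-≗ (λ l₀ → cong (λ g → g l r) (G-right l₀))) ⟩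
    ∑ (λ r₀ → popR r₀ l r) + ∑ (λ l₀ → popL l₀ l r)                      ≡⟨ cong₂ _+_ (sym (*-distribˡ-sum (1 ∸ F l r) (λ r₀ → δ (c l r₀) (c l r)))) (sym (*-distribˡ-sum (1 ∸ H l r) (λ l₀ → δ (c l₀ r) (c l r)))) ⟩
    (1 ∸ F l r) * class (c l) (c l r) + (1 ∸ H l r) * class (λ l′ → c l′ r) (c l r) ≤⟨ +-mono-≤ (small-class≤ q (c l) (c l r)) (small-class≤ q (λ l′ → c l′ r) (c l r)) ⟩
    q + q                                                                ∎
    where open ≤-Reasoning

  G-total : ∀ z → ∑∑ (G z) ≤ n * q
  G-total = G-elim (λ g → ∑∑ g ≤ n * q)
    (λ r₀ → ∑-bound q λ l → small-members≤ q (c l) (c l r₀))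
    (λ l₀ → ≤-trans (≤-reflexive (∑-comm (popL l₀))) (∑-bound q λ r → small-members≤ q (λ l → c l r) (c l₀ r)))

  open BalancedMatching F H (λ l r → ind≤1 (q <? class (c l) (c l r))) (λ l r → ind≤1 (q <? class (λ l′ → c l′ r) (c l r)))
    G G≤1 b q (q + q) W (λ l → large≤b (inj₁ l)) (λ r → large≤b (inj₂ r)) (2b<n 3≤q (s≤s z≤n)) G-sum G-total

  module _ (π : Permutation′ n) (ad : Admissible π)
    (average : W * (n * stat C π + n * stat C π) + v 3≤q * (2 * ∑ (λ z → stat (G z) π * stat (G z) π)) ≤
               W * (2 * (n * b + n * b)) + (4 * (n * q) * (n * (q + q)) + n * (n * (8 * (q + q))))) where

    private
      Q = ∑ (λ z → stat (G z) π * stat (G z) π)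

    stat-G≤h : ∀ z → stat (G z) π ≤ h
    stat-G≤h z = root-bound 3≤q large-n (stat C π) Q average (stat (G z) π) (∑-term (λ z → stat (G z) π * stat (G z) π) z)

    module _ (i₀ : Fin n) where

      -- Relabels the tiles so that the prescribed tile i₀ becomes tile zero, the one inserted last.
      λₚ : Permutation′ n
      λₚ = transpose zero i₀

      L R : Fin n → Fin n
      L i = λₚ ⟨$⟩ʳ i
      R i = π ⟨$⟩ʳ L i

      L-inj : Injective _≡_ _≡_ L
      L-inj = perm-injective λₚ

      R-inj : Injective _≡_ _≡_ R
      R-inj = L-inj ∘ perm-injective π

      e : Fin n → Fin n → ℕ
      e i j = c (L i) (R j)

      u w : Fin n → ℕ
      u i = H (L i) (R i)
      w i = F (L i) (R i)

      tiling : Tiling e u w A q h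
      tiling = record
        { disjoint = λ i → Sum.swap (ad (L i))
        ; outClass = λ i → ≤-trans (out-inj i) (class≤A (inj₂ (R i)) (e i i))
        ; outSmall = λ i ui≡0 → ≤-trans (out-inj i) (small⇒class≤ q (λ l → c l (R i)) (e i i) ui≡0)
        ; inClass  = λ j → ≤-trans (in-inj j) (class≤A (inj₁ (L j)) (e j j))
        ; inSmall  = λ j wj≡0 → ≤-trans (in-inj j) (small⇒class≤ q (c (L j)) (e j j) wj≡0)
        ; outPop   = λ i → ≤-trans (∑-inj L-inj (λ l → popR (R i) l (π ⟨$⟩ʳ l))) (subst (λ g → stat g π ≤ h) (G-left (R i)) (stat-G≤h (R i ↑ˡ n)))
        ; inPop    = λ j → ≤-trans (∑-inj L-inj (λ l → popL (L j) l (π ⟨$⟩ʳ l))) (subst (λ g → stat g π ≤ h) (G-right (L j)) (stat-G≤h (n ↑ʳ L j)))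
        }
        where
        out-inj : ∀ i → ∑ (λ j → δ (e j i) (e i i)) ≤ class (λ l → c l (R i)) (e i i)
        out-inj i = ∑-inj L-inj (λ l → δ (c l (R i)) (e i i))
        in-inj : ∀ j → ∑ (λ i → δ (e j i) (e j j)) ≤ class (c (L j)) (e j j)
        in-inj j = ∑-inj R-inj (λ r → δ (c (L j) r) (e j j))

      u+w≤cost : ∑ u + ∑ w ≤ stat C π
      u+w≤cost = begin
        ∑ u + ∑ w                          ≡⟨ +-comm (∑ u) (∑ w) ⟩
        ∑ w + ∑ u                          ≡⟨ sym (∑-distrib-+ w u) ⟩
        ∑ (λ i → w i + u i)                ≤⟨ ∑-inj L-inj (λ l → C l (π ⟨$⟩ʳ l)) ⟩
        stat C π                           ∎
        where open ≤-Reasoning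

      tiling-size : ∑ u + ∑ w + A + 4 * h + 3 * q < N
      -- One unit of the 2 pays for the strict inequality, the other for the omitted tile zero.
      tiling-size = s≤s⁻¹ (begin
        2 + (∑ u + ∑ w + A + 4 * h + 3 * q)      ≡⟨ +-comm 2 _ ⟩
        ∑ u + ∑ w + A + 4 * h + 3 * q + 2        ≤⟨ +-monoˡ-≤ 2 (+-monoˡ-≤ (3 * q) (+-monoˡ-≤ (4 * h) (+-monoˡ-≤ A u+w≤cost))) ⟩
        stat C π + A + 4 * h + 3 * q + 2         ≤⟨ size 3≤q large-n (stat C π) Q average ⟩
        n                                        ∎)
        where open ≤-Reasoning

      walk : ∀ k → k < N → ClosedWalk e zero (suc k)
      walk = closedWalk tiling tiling-size

      cycle-L : ∀ k → k < N → HasPCCycleThrough c (2 * suc (suc k)) (inj₁ i₀)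
      cycle-L k k<N = cycle-left c L-inj R-inj (walk k k<N)

      cycle-R : ∀ k → k < N → HasPCCycleThrough c (2 * suc (suc k)) (inj₂ (π ⟨$⟩ʳ i₀))
      cycle-R k k<N = cycle-right c L-inj R-inj (walk k k<N)

  evenPancyclic : ∀ x k → k < N → HasPCCycleThrough c (2 * suc (suc k)) x
  evenPancyclic x k k<N = let π , ad , average = balanced (v 3≤q) (v+2b≤n 3≤q) in through π ad average x
    where
    through : ∀ π (ad : Admissible π) average x → HasPCCycleThrough c (2 * suc (suc k)) x
    through π ad average (inj₁ l) = cycle-L π ad average l k k<N
    -- r is the right end of the tile whose left end is its preimage under π.
    through π ad average (inj₂ r) = subst (HasPCCycleThrough c (2 * suc (suc k)) ∘ inj₂) (Perm.inverseʳ π) (cycle-R π ad average (π ⟨$⟩ˡ r) k k<N)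

-- Clearing denominators in the degree condition

open import Data.Integer using (+_)
import Data.Integer as ℤ
import Data.Integer.Properties as ℤ
open import Data.Rational using (ℚ; 0ℚ; mkℚ; toℚᵘ) renaming (_<_ to _<ℚ_; _≤_ to _≤ℚ_; _*_ to _*ℚ_; _+_ to _+ℚ_; _/_ to _/ℚ_)
import Data.Rational as ℚ
import Data.Rational.Properties as ℚ
import Data.Rational.Unnormalised as ℚᵘ
import Data.Rational.Unnormalised.Properties as ℚᵘ

-- q is the denominator of ε. Its numerator is positive, so ε ≥ 1/q, and only this lower bound is
-- kept.
degree-condition : ∀ (ε : ℚ) → 0ℚ <ℚ ε → ∃ λ q-1 → ∀ n d →
  ((+ 2 /ℚ 3) +ℚ ε) *ℚ (+ n /ℚ 1) ≤ℚ (+ d /ℚ 1) → (2 * suc q-1 + 3) * n ≤ 3 * suc q-1 * d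
degree-condition ε@(mkℚ (+ suc p) q-1 cop) 0<ε = q-1 , clear
  where
  clear : ∀ n d → ((+ 2 /ℚ 3) +ℚ ε) *ℚ (+ n /ℚ 1) ≤ℚ (+ d /ℚ 1) → (2 * suc q-1 + 3) * n ≤ 3 * suc q-1 * d
  clear n d le = ≤-trans (*-monoˡ-≤ n (+-monoʳ-≤ (2 * suc q-1) (*-monoˡ-≤ 3 (s≤s (z≤n {p}))))) (ℤ.drop‿+≤+ (subst₂ ℤ._≤_ lhs rhs (ℚᵘ.drop-*≤* unnormalised)))
    where
    -- Passing to unnormalised fractions exposes numerators and denominators without reduction to
    -- lowest terms.
    unnormalised : (ℚᵘ.mkℚᵘ (+ 2) 2 ℚᵘ.+ toℚᵘ ε) ℚᵘ.* ℚᵘ.mkℚᵘ (+ n) 0 ℚᵘ.≤ ℚᵘ.mkℚᵘ (+ d) 0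
    unnormalised = ℚᵘ.≤-respˡ-≃ left (ℚᵘ.≤-respʳ-≃ (ℚ.toℚᵘ-fromℚᵘ (ℚᵘ.mkℚᵘ (+ d) 0)) (ℚ.toℚᵘ-mono-≤ le))
      where
      left : toℚᵘ (((+ 2 /ℚ 3) +ℚ ε) *ℚ (+ n /ℚ 1)) ℚᵘ.≃ (ℚᵘ.mkℚᵘ (+ 2) 2 ℚᵘ.+ toℚᵘ ε) ℚᵘ.* ℚᵘ.mkℚᵘ (+ n) 0
      left = ℚᵘ.≃-trans (ℚ.toℚᵘ-homo-* ((+ 2 /ℚ 3) +ℚ ε) (+ n /ℚ 1))
        (ℚᵘ.*-cong (ℚ.toℚᵘ-homo-+ (+ 2 /ℚ 3) ε) (ℚ.toℚᵘ-fromℚᵘ (ℚᵘ.mkℚᵘ (+ n) 0)))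
    lhs : ((+ 2) ℤ.* (+ suc q-1) ℤ.+ (+ suc p) ℤ.* (+ 3)) ℤ.* (+ n) ℤ.* (+ 1) ≡ + ((2 * suc q-1 + suc p * 3) * n)
    lhs = trans (ℤ.*-identityʳ _) (trans (cong (ℤ._* (+ n)) (trans (cong₂ ℤ._+_ (sym (ℤ.pos-* 2 (suc q-1))) (sym (ℤ.pos-* (suc p) 3))) (sym (ℤ.pos-+ (2 * suc q-1) (suc p * 3))))) (sym (ℤ.pos-* (2 * suc q-1 + suc p * 3) n)))
    rhs : (+ d) ℤ.* (+ (3 * suc q-1 * 1)) ≡ + (3 * suc q-1 * d)
    rhs = trans (sym (ℤ.pos-* d (3 * suc q-1 * 1))) (cong +_ (trans (cong (d *_) (*-identityʳ (3 * suc q-1))) (*-comm d (3 * suc q-1))))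
degree-condition (mkℚ (+ zero) _ _) (ℚ.*<* (ℤ.+<+ ()))
degree-condition (mkℚ (ℤ.-[1+ _ ]) _ _) (ℚ.*<* ())

theorem1p5 : (ε : ℚ) → 0ℚ <ℚ ε →
    ∃ λ (n₀ : ℕ) → ∀ (n : ℕ) → n₀ ≤ n → (c : Coloring n) →
    (∀ (v : Vertex n) → ((+ 2 /ℚ 3) +ℚ ε) *ℚ (+ n /ℚ 1) ≤ℚ (+ colorDegree c v /ℚ 1)) →
    ∀ (u : Vertex n) (m : ℕ) → 2 ≤ m → 2 * m ≤ 2 * n →
    HasPCCycleThrough c (2 * m) u
-- The threshold depends on q alone, so it may be evaluated at n = 0.
theorem1p5 ε 0<ε = Constants.threshold q-1 0 , prove
  where
  q-1 = proj₁ (degree-condition ε 0<ε)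
  prove : ∀ n → Constants.threshold q-1 0 ≤ n → (c : Coloring n) →
    (∀ (v : Vertex n) → ((+ 2 /ℚ 3) +ℚ ε) *ℚ (+ n /ℚ 1) ≤ℚ (+ colorDegree c v /ℚ 1)) →
    ∀ (u : Vertex n) (m : ℕ) → 2 ≤ m → 2 * m ≤ 2 * n → HasPCCycleThrough c (2 * m) u
  prove zero    _       c deg u m 2≤m 2m≤2n = contradiction (≤-trans 2≤m (*-cancelˡ-≤ {m} {0} 2 2m≤2n)) λ ()
  prove (suc N) large-n c deg u (suc (suc k)) (s≤s (s≤s _)) 2m≤2n =
    EvenPancyclicity.evenPancyclic q-1 N c large-n (λ v → proj₂ (degree-condition ε 0<ε) (suc N) (colorDegree c v) (deg v)) u k
      (s≤s⁻¹ (*-cancelˡ-≤ 2 2m≤2n))
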